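{- For every $\varepsilon>0$ there exists a sequence of unsatisfiable hitting formulas $G_m$, each containing $2^{\tilde O(m)}$ clauses of width $\tilde O(m)$, such that every tree-like Res$(\oplus)$ refutation of $G_m$ has size $2^{\tilde\Omega(m^{2-\varepsilon})}$.
   Context: A hitting formula is a CNF in which every two distinct clauses contain complementary literals. The width of a clause is its number of literals. Res$(\oplus)$ is the proof system whose lines are linear clauses, i.e., disjunctions of affine equations over $\mathrm{GF}(2)$ of the form $\bigoplus_{i\in I}x_i=c$ (a literal $x$ is the equation $x=1$, $\bar x$ is $x=0$; an assignment falsifies a linear clause iff it falsifies all its equations). Its rules are the resolution rule: from $C\vee(f=0)$ and $D\vee(f=1)$ derive $C\vee D$ (where $f$ is a linear form), and the weakening rule: from $C$ derive any linear clause $D$ semantically implied by $C$. A refutation of a CNF $F$ derives the empty clause from the clauses of $F$. A tree-like Res$(\oplus)$ refutation is one in which every derived line is used at most once as a premise; size is the number of lines. $\tilde O(f)=O(f\log^C f)$, $\tilde\Omega(f)=\Omega(f/\log^C f)$ for some constant $C$. -}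

module Defs where

open import Data.Nat using (ℕ; zero; suc; _+_; _*_; _^_; _≤_; _<_)
open import Data.Nat.Logarithm using (⌊log₂_⌋)
open import Data.Bool using (Bool; true; false; not; _xor_; _∧_)
open import Data.Fin using (Fin; _≟_)
open import Data.Vec using (Vec; tabulate; zipWith; foldr′)
open import Data.List using (List; []; _∷_; _++_; length; map; lookup)
open import Data.List.Membership.Propositional using (_∈_)
open import Data.List.Relation.Unary.Any using (Any)
open import Data.List.Relation.Unary.All using (All)
open import Data.List.Relation.Binary.Permutation.Propositional using (_↭_)
open import Data.Product using (Σ; _×_; _,_; ∃-syntax)
open import Relation.Binary.PropositionalEquality using (_≡_)
open import Relation.Nullary using (¬_)
open import Relation.Nullary.Decidable using (⌊_⌋)

Assignment : ℕ → Set
Assignment n = Fin n → Bool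

-- literal (i , b) is the equation x_i = b  (x is (i,true), x̄ is (i,false))
Literal : ℕ → Set
Literal n = Fin n × Bool

Clause : ℕ → Set
Clause n = List (Literal n)

CNF : ℕ → Set
CNF n = List (Clause n)

width : ∀ {n} → Clause n → ℕ
width = length

LitSat : ∀ {n} → Assignment n → Literal n → Set
LitSat α (i , b) = α i ≡ b

ClauseSat : ∀ {n} → Assignment n → Clause n → Set
ClauseSat α C = Any (LitSat α) C

Unsatisfiable : ∀ {n} → CNF n → Set
Unsatisfiable {n} F = (α : Assignment n) → ¬ All (ClauseSat α) F

Clashing : ∀ {n} → Clause n → Clause n → Set
Clashing C D = Σ _ λ i → Σ Bool λ b → ((i , b) ∈ C) × ((i , not b) ∈ D)

Hitting : ∀ {n} → CNF n → Set
Hitting F = ∀ i j → ¬ (i ≡ j) → Clashing (lookup F i) (lookup F j)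

-- linear form ⊕_{i∈I} x_i, I given by its indicator vector
LinForm : ℕ → Set
LinForm n = Vec Bool n

evalForm : ∀ {n} → LinForm n → Assignment n → Bool
evalForm {n} I α = foldr′ _xor_ false (zipWith _∧_ I (tabulate α))

LinEq : ℕ → Set
LinEq n = LinForm n × Bool

EqSat : ∀ {n} → Assignment n → LinEq n → Set
EqSat α (f , c) = evalForm f α ≡ c

LinClause : ℕ → Set
LinClause n = List (LinEq n)

LinSat : ∀ {n} → Assignment n → LinClause n → Set
LinSat α D = Any (EqSat α) D

Implies : ∀ {n} → LinClause n → LinClause n → Set
Implies {n} C D = (α : Assignment n) → LinSat α C → LinSat α D

litToEq : ∀ {n} → Literal n → LinEq n
litToEq (i , b) = tabulate (λ j → ⌊ j ≟ i ⌋) , b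

clauseToLin : ∀ {n} → Clause n → LinClause n
clauseToLin = map litToEq

-- Tree-like Res(⊕) derivations (lines are linear clauses, viewed as
-- disjunctions, so premises match up to permutation).  A tree: each
-- derived line is used at most once as a premise.

data TreeDeriv {n} (F : CNF n) : LinClause n → Set where
  axiom : ∀ {C} → C ∈ F → TreeDeriv F (clauseToLin C)
  res   : ∀ {P₁ P₂} (f : LinForm n) (C D : LinClause n) →
          TreeDeriv F P₁ → TreeDeriv F P₂ →
          P₁ ↭ ((f , false) ∷ C) → P₂ ↭ ((f , true) ∷ D) →
          TreeDeriv F (C ++ D)
  weak  : ∀ {C D} → TreeDeriv F C → Implies C D → TreeDeriv F D

size : ∀ {n} {F : CNF n} {C} → TreeDeriv F C → ℕ
size (axiom _) = 1
size (res _ _ _ π₁ π₂ _ _) = suc (size π₁ + size π₂)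
size (weak π _) = suc (size π)

TreeRefutation : ∀ {n} → CNF n → Set
TreeRefutation F = TreeDeriv F []

-- log factor used for Õ / Ω̃ : L m = ⌊log₂ m⌋ + 1 (≥ 1)

L : ℕ → ℕ
L m = suc ⌊log₂ m ⌋

-- A hitting formula is a partition of the cube into subcubes, one per clause. From
-- a function f whose certificates have size a and whose unambiguous certificates
-- have size u, form OR_N ∘ AND_N ∘ f and then its cheat-sheet version: log d copies
-- of the input, whose values address a cell in which certificates for these values
-- must be written. Up to logarithms this takes (a, u, depth d) to
-- (N a, N (N a + u), N² d), so that k rounds turn a single variable into a function
-- with a partition of width N^(k+1) and query depth N^2k. Replacing every variable
-- by the majority of three new ones lifts depth to size: whenever the form resolved
-- upon is not constant, one of its variables is made the pivot, the other two in its
-- block fix the value of the majority according to the query adversary, and the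
-- pivot can still give the form either value.

module Submission where

open import Defs
open import Data.Nat using (ℕ; _+_; _*_; _^_; _≤_; _<_)
open import Data.List using (length)
open import Data.List.Relation.Unary.All using (All)
open import Data.Product using (Σ; _×_; _,_; proj₁; proj₂; ∃-syntax)
open import Data.Bool using (Bool; true; false; not; _xor_; _∧_; if_then_else_)
import Data.Bool as Bool
open import Data.Bool.Properties using (not-involutive; not-¬; ¬-not; xor-identityʳ)
import Data.Bool.Solver as BoolSolver
open import Data.Empty using (⊥; ⊥-elim)
open import Data.Fin using (Fin; zero; suc)
import Data.Fin as Fin
open import Data.List using (List; []; _∷_; _++_; map; [_]; cartesianProduct; allFin; filter)
import Data.List as List
open import Data.List.Membership.Propositional using (_∈_; _∉_)
open import Data.List.Membership.Propositional.Properties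
  using (∈-map⁺; ∈-map⁻; ∈-++⁺ˡ; ∈-++⁺ʳ; ∈-++⁻; ∈-filter⁺; ∈-filter⁻; ∈-lookup; ∈-cartesianProduct⁺; ∈-allFin)
import Data.List.Membership.DecPropositional as DecMembership
open import Data.List.Properties using (++-identityʳ; ∷-injectiveˡ; length-map; length-++; length-filter)
open import Data.List.Relation.Binary.Permutation.Propositional.Properties using (Any-resp-↭)
open import Data.List.Relation.Unary.All as All using ([]; _∷_)
import Data.List.Relation.Unary.All.Properties as All
open import Data.List.Relation.Unary.AllPairs as AllPairs using (AllPairs; []; _∷_)
import Data.List.Relation.Unary.AllPairs.Properties as AllPairs
open import Data.List.Relation.Unary.Any using (Any; here; there; any?; index)
import Data.List.Relation.Unary.Any.Properties as Any
open import Data.Maybe using (Maybe; just; nothing)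
open import Data.Nat using (zero; suc; pred; z≤n; s≤s; s≤s⁻¹; ⌊_/2⌋; ⌈_/2⌉; NonZero)
open import Data.Nat.DivMod using (_/_; m≡m%n+[m/n]*n; m%n<n; m/n*n≤m)
open import Data.Nat.Induction using (<-wellFounded)
open import Data.Nat.Logarithm using (⌊log₂_⌋; ⌊log₂⌋-mono-≤; ⌊log₂[2^n]⌋≡n)
open import Data.Nat.Logarithm.Core using (⌊log2⌋)
open import Data.Nat.Properties hiding (_≟_)
open import Data.Nat.Solver using (module +-*-Solver)
open import Data.Product using (∃)
import Data.Product.Properties as Product
open import Data.Sum using (_⊎_; inj₁; inj₂; [_,_]′)
open import Data.Unit using (⊤; tt)
open import Data.Vec using (Vec; []; _∷_; tabulate; lookup)
open import Data.Vec.Properties using (∷-injectiveʳ; tabulate-cong; tabulate∘lookup; lookup∘tabulate; ≡-dec)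
open import Function using (_∘_)
open import Induction.WellFounded using (Acc; acc)
open import Relation.Binary using (DecidableEquality)
open import Relation.Binary.PropositionalEquality hiding ([_])
open import Relation.Nullary using (Dec; yes; no; does; contradiction; ¬_; ¬?)
open import Relation.Nullary.Decidable using (dec-true; dec-false; ⌊_⌋; isYes≗does; map′)

-- Composing with OR_N ∘ AND_N multiplies certificates by N and depth by N², but spoils unambiguity:
-- a partition must certify every conjunct before the first false one and every disjunct before the
-- first true one. Cheat sheets repair this for the value 1 alone. A valid cell proves the address
-- that leads to it, so it is unique and can be guessed, and unambiguous 1-certificates become about
-- as short as ordinary ones; the value 0 still pays for reading the address. Hence the invariant of
-- the rounds: ordinary certificates and unambiguous 1-certificates cost Z, unambiguous
-- 0-certificates cost Z N. Since its 1-side is cheap, the next AND_N costs N Z + Z N, and a round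
-- multiplies both bounds by N only, up to logarithms. The surplus factor N of the 0-side survives
-- to the end and is the source of ε: the exponent reached is 2k / (k + 1).
--
-- Read from the empty clause, a refutation leads to a falsified axiom, and the cube of that axiom
-- carries a value of the function. A tree refutation therefore computes the lifted function, which
-- is what makes query depth relevant.

private variable
  V W X Y : Set

-- Nondeterministic decision trees

-- The outcomes on α range over all guesses, so a program that Computes f is an unambiguous certificate scheme for f, that is, a
-- partition of the cube into subcubes on which f is constant.
data Prog (V X : Set) : Set where
  ret   : X → Prog V X
  fail  : Prog V X
  ask   : V → (Bool → Prog V X) → Prog V X
  guess : (Bool → Prog V X) → Prog V X

outcomes : Prog V X → (V → Bool) → List X
outcomes (ret x)   α = [ x ]
outcomes fail      α = []
outcomes (ask v k) α = outcomes (k (α v)) α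
outcomes (guess k) α = outcomes (k false) α ++ outcomes (k true) α

Computes : Prog V X → ((V → Bool) → X) → Set
Computes p f = ∀ α → outcomes p α ≡ [ f α ]

infixl 1 _>>=_

_>>=_ : Prog V X → (X → Prog V Y) → Prog V Y
ret x   >>= k = k x
fail    >>= k = fail
ask v h >>= k = ask v λ b → h b >>= k
guess h >>= k = guess λ b → h b >>= k

subst-ask : (V → Prog W Bool) → Prog V X → Prog W X
subst-ask q (ret x)   = ret x
subst-ask q fail      = fail
subst-ask q (ask v k) = q v >>= λ b → subst-ask q (k b)
subst-ask q (guess k) = guess λ b → subst-ask q (k b)

rename : (V → W) → Prog V X → Prog W X
rename ρ = subst-ask λ v → ask (ρ v) ret

outcomes-fail : (p : Prog V X) {k : X → Prog V Y} (α : V → Bool) →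
  outcomes p α ≡ [] → outcomes (p >>= k) α ≡ []
outcomes-fail fail      α e = refl
outcomes-fail (ask v h) α e = outcomes-fail (h (α v)) α e
outcomes-fail (guess h) α e with outcomes (h false) α in e₀
... | [] = cong₂ _++_ (outcomes-fail (h false) α e₀) (outcomes-fail (h true) α e)

-- A guess with a single outcome has it in exactly one branch. The other branch has none, and
-- `outcomes-fail` keeps it empty under the continuation.
outcomes-bind : (p : Prog V X) {k : X → Prog V Y} (α : V → Bool) {x : X} →
  outcomes p α ≡ [ x ] → outcomes (p >>= k) α ≡ outcomes (k x) α
outcomes-bind (ret x)   α refl = refl
outcomes-bind (ask v h) α e = outcomes-bind (h (α v)) α e
outcomes-bind (guess h) {k} α e with outcomes (h false) α in e₀
... | [] = cong₂ _++_ (outcomes-fail (h false) α e₀) (outcomes-bind (h true) α e)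
... | y ∷ [] with outcomes (h true) α in e₁
outcomes-bind (guess h) {k} α {x} refl | y ∷ [] | [] =
  trans (cong₂ _++_ (outcomes-bind (h false) α e₀) (outcomes-fail (h true) α e₁)) (++-identityʳ _)

outcomes-subst-ask : {q : V → Prog W Bool} {φ : V → (W → Bool) → Bool} →
  (∀ v → Computes (q v) (φ v)) →
  (p : Prog V X) (α : W → Bool) → outcomes (subst-ask q p) α ≡ outcomes p (λ v → φ v α)
outcomes-subst-ask c (ret x)   α = refl
outcomes-subst-ask c fail      α = refl
outcomes-subst-ask {q = q} {φ} c (ask v k) α =
  trans (outcomes-bind (q v) α (c v α)) (outcomes-subst-ask c (k (φ v α)) α)
outcomes-subst-ask c (guess k) α =
  cong₂ _++_ (outcomes-subst-ask c (k false) α) (outcomes-subst-ask c (k true) α)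

rename-computes : (ρ : V → W) (p : Prog V X) {f : (V → Bool) → X} → Computes p f →
  Computes (rename ρ p) (λ α → f (α ∘ ρ))
rename-computes ρ p c α =
  trans (outcomes-subst-ask (λ v β → refl) p α) (c (α ∘ ρ))

outcomes-ext : (p : Prog V X) {α β : V → Bool} → α ≗ β → outcomes p α ≡ outcomes p β
outcomes-ext (ret x)   e = refl
outcomes-ext fail      e = refl
outcomes-ext (ask v k) {α} {β} e rewrite e v = outcomes-ext (k (β v)) e
outcomes-ext (guess k) e = cong₂ _++_ (outcomes-ext (k false) e) (outcomes-ext (k true) e)

-- Programs see their input only pointwise, so a computed function respects pointwise equality; this
-- replaces function extensionality throughout.
computes-ext : {p : Prog V X} {f : (V → Bool) → X} → Computes p f →
  {α β : V → Bool} → α ≗ β → f α ≡ f β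
computes-ext {p = p} c {α} {β} e =
  ∷-injectiveˡ (trans (sym (c α)) (trans (outcomes-ext p e) (c β)))

bind-computes : {p : Prog V X} {k : X → Prog V Y} {f : (V → Bool) → X}
  {g : X → (V → Bool) → Y} → Computes p f → (∀ x → Computes (k x) (g x)) →
  Computes (p >>= k) (λ α → g (f α) α)
bind-computes {p = p} {f = f} c d α = trans (outcomes-bind p α (c α)) (d (f α) α)

-- Asks and guesses are both charged, so a cost bound controls the width of the
-- certificates as well as, by Kraft's inequality, their number.
Within : ℕ → Prog V X → (X → ℕ) → Set
Within n (ret x)   B = n ≤ B x
Within n fail      B = ⊤
Within n (ask v k) B = ∀ b → Within (suc n) (k b) B
Within n (guess k) B = ∀ b → Within (suc n) (k b) B

Cost : Prog V X → (X → ℕ) → Set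
Cost = Within 0

within-mono : (p : Prog V X) {m n : ℕ} {B C : X → ℕ} → m ≤ n → (∀ x → B x ≤ C x) →
  Within n p B → Within m p C
within-mono (ret x)   m≤n B≤C w = ≤-trans m≤n (≤-trans w (B≤C x))
within-mono fail      m≤n B≤C w = tt
within-mono (ask v k) m≤n B≤C w b = within-mono (k b) (s≤s m≤n) B≤C (w b)
within-mono (guess k) m≤n B≤C w b = within-mono (k b) (s≤s m≤n) B≤C (w b)

within-bind : (p : Prog V X) {k : X → Prog V Y} {n : ℕ} {B : X → ℕ} {C : Y → ℕ} →
  Within n p B → (∀ x → Within (B x) (k x) C) → Within n (p >>= k) C
within-bind (ret x)   {k} w h = within-mono (k x) w (λ _ → ≤-refl) (h x)
within-bind fail      w h = tt
within-bind (ask v g) w h b = within-bind (g b) (w b) h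
within-bind (guess g) w h b = within-bind (g b) (w b) h

within-shift : ∀ n (p : Prog V X) {m : ℕ} {B : X → ℕ} →
  Within m p B → Within (m + n) p (λ x → B x + n)
within-shift n (ret x)   w = +-monoˡ-≤ n w
within-shift n fail      w = tt
within-shift n (ask v k) w b = within-shift n (k b) (w b)
within-shift n (guess k) w b = within-shift n (k b) (w b)

cost-from : ∀ n (p : Prog V X) {B : X → ℕ} {C : X → ℕ} → Cost p B →
  (∀ x → B x + n ≤ C x) → Within n p C
cost-from n p w h = within-mono p ≤-refl h (within-shift n p w)

-- A guess keeps its charge of 1 under the substitution while the bound grows by `w`; hence `w ≢ 0`.
within-subst-ask : ∀ w {q : V → Prog W Bool} → (∀ v → Cost (q v) (λ _ → w)) → w ≢ 0 →
  (p : Prog V X) {n : ℕ} {B : X → ℕ} →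
  Within n p B → Within (n * w) (subst-ask q p) (λ x → B x * w)
within-subst-ask w c w≢0 (ret x)   h = *-monoˡ-≤ w h
within-subst-ask w c w≢0 fail      h = tt
within-subst-ask w {q} c w≢0 (ask v k) {n} h =
  within-bind (q v) {B = λ _ → suc n * w} (cost-from (n * w) (q v) (c v) λ _ → ≤-refl)
    λ b → within-subst-ask w c w≢0 (k b) (h b)
within-subst-ask w c w≢0 (guess k) {n} h b =
  within-mono (subst-ask _ (k b)) (+-monoˡ-≤ (n * w) (n≢0⇒n>0 w≢0)) (λ _ → ≤-refl)
    (within-subst-ask w c w≢0 (k b) (h b))

rename-cost : (ρ : V → W) (p : Prog V X) {B : X → ℕ} → Cost p B → Cost (rename ρ p) B
rename-cost ρ p {B} h = within-mono (rename ρ p) z≤n (λ x → ≤-reflexive (*-identityʳ (B x)))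
  (within-subst-ask 1 (λ v b → ≤-refl) (λ ()) p h)

sequence : ∀ c → (Fin c → Prog V X) → Prog V (Vec X c)
sequence zero    p = ret []
sequence (suc c) p = p zero >>= λ x → sequence c (p ∘ suc) >>= λ xs → ret (x ∷ xs)

sequence-computes : ∀ c {p : Fin c → Prog V X} {f : Fin c → (V → Bool) → X} →
  (∀ i → Computes (p i) (f i)) → Computes (sequence c p) (λ α → tabulate λ i → f i α)
sequence-computes zero    h α = refl
sequence-computes (suc c) {p} {f} h =
  bind-computes {p = p zero} {f = f zero} (h zero) λ x →
    bind-computes {p = sequence c (p ∘ suc)} (sequence-computes c (h ∘ suc)) λ xs α → refl

sequence-cost : ∀ c {p : Fin c → Prog V X} {w : ℕ} → (∀ i → Cost (p i) (λ _ → w)) →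
  Cost (sequence c p) (λ _ → c * w)
sequence-cost zero    h = z≤n
sequence-cost (suc c) {p} {w} h =
  within-bind (p zero) (h zero) λ x →
    within-bind (sequence c (p ∘ suc)) {B = λ _ → suc c * w}
      (cost-from w (sequence c (p ∘ suc)) (sequence-cost c (h ∘ suc))
        λ _ → ≤-reflexive (+-comm (c * w) w))
      λ xs → ≤-refl

guessVec : ∀ c → (Vec Bool c → Prog V X) → Prog V X
guessVec zero    k = k []
guessVec (suc c) k = guess λ b → guessVec c (k ∘ (b ∷_))

guessVec-fail : ∀ c {k : Vec Bool c → Prog V X} {α : V → Bool} →
  (∀ bs → outcomes (k bs) α ≡ []) → outcomes (guessVec c k) α ≡ []
guessVec-fail zero    h = h []
guessVec-fail (suc c) h =
  cong₂ _++_ (guessVec-fail c (h ∘ (false ∷_))) (guessVec-fail c (h ∘ (true ∷_)))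

guessVec-only : ∀ c {k : Vec Bool c → Prog V X} {α : V → Bool} (bs : Vec Bool c) →
  (∀ cs → cs ≢ bs → outcomes (k cs) α ≡ []) → outcomes (guessVec c k) α ≡ outcomes (k bs) α
guessVec-only zero    []           h = refl
guessVec-only (suc c) (false ∷ bs) h =
  trans (cong₂ _++_ (guessVec-only c bs λ cs ne → h (false ∷ cs) (ne ∘ ∷-injectiveʳ))
                    (guessVec-fail c λ cs → h (true ∷ cs) λ ()))
        (++-identityʳ _)
guessVec-only (suc c) (true ∷ bs) h =
  cong₂ _++_ (guessVec-fail c λ cs → h (false ∷ cs) λ ())
             (guessVec-only c bs λ cs ne → h (true ∷ cs) (ne ∘ ∷-injectiveʳ))

guessVec-within : ∀ c {k : Vec Bool c → Prog V X} {n : ℕ} {B : X → ℕ} →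
  (∀ bs → Within (c + n) (k bs) B) → Within n (guessVec c k) B
guessVec-within zero    h = h []
guessVec-within (suc c) {k} {n} {B} h b =
  guessVec-within c λ bs → subst (λ m → Within m (k (b ∷ bs)) B) (sym (+-suc c n)) (h (b ∷ bs))

-- Functions with certificates

Finite : Set → Set
Finite A = Σ (List A) λ xs → ∀ a → a ∈ xs

finite-Bool : Finite Bool
finite-Bool = false ∷ true ∷ [] , λ { false → here refl ; true → there (here refl) }

finite-× : Finite V → Finite W → Finite (V × W)
finite-× (xs , p) (ys , q) = cartesianProduct xs ys , λ (v , w) → ∈-cartesianProduct⁺ (p v) (q w)

finite-⊎ : Finite V → Finite W → Finite (V ⊎ W)
finite-⊎ (xs , p) (ys , q) = map inj₁ xs ++ map inj₂ ys , λ
  { (inj₁ v) → ∈-++⁺ˡ (∈-map⁺ inj₁ (p v))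
  ; (inj₂ w) → ∈-++⁺ʳ (map inj₁ xs) (∈-map⁺ inj₂ (q w)) }

finite-Maybe : Finite V → Finite (Maybe V)
finite-Maybe (xs , p) = nothing ∷ map just xs , λ
  { nothing → here refl ; (just v) → there (∈-map⁺ just (p v)) }

finite-Fin : ∀ n → Finite (Fin n)
finite-Fin n = allFin n , ∈-allFin

finite-Vec : ∀ n → Finite (Vec Bool n)
finite-Vec zero    = [] ∷ [] , λ { [] → here refl }
finite-Vec (suc n) = let (xs , p) = finite-Vec n in
  map (false ∷_) xs ++ map (true ∷_) xs , λ
    { (false ∷ v) → ∈-++⁺ˡ (∈-map⁺ (false ∷_) (p v))
    ; (true ∷ v)  → ∈-++⁺ʳ (map (false ∷_) xs) (∈-map⁺ (true ∷_) (p v)) }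

-- Membership up to pointwise equality: witnesses get rebuilt from their components and are then
-- only pointwise equal to the original.
_∋_ : ((V → Bool) → Set) → (V → Bool) → Set
P ∋ α = ∀ β → β ≗ α → P β

infixl 5 _∩_≔_
_∩_≔_ : ((V → Bool) → Set) → V → Bool → ((V → Bool) → Set)
(P ∩ v ≔ b) α = P α × α v ≡ b

-- P is what is known about the input: an adversary keeps both values of f
-- possible for d more queries.
Hard : ((V → Bool) → Bool) → ℕ → ((V → Bool) → Set) → Set
Hard f zero    P = ⊤
Hard f (suc d) P =
  (∀ b → ∃ λ α → f α ≡ b × P ∋ α) × (∀ v → ∃ λ b → Hard f d (P ∩ v ≔ b))

hard-mono : ∀ {f : (V → Bool) → Bool} d {P Q} → (∀ α → P α → Q α) → Hard f d P → Hard f d Q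
hard-mono zero    P⊆Q h       = tt
hard-mono (suc d) P⊆Q (w , h) =
  (λ b → let (α , e , i) = w b in α , e , λ β β≗α → P⊆Q β (i β β≗α)) ,
  (λ v → let (b , h′) = h v in b , hard-mono d (λ α (p , e) → P⊆Q α p , e) h′)

hard-pred : ∀ {f : (V → Bool) → Bool} d {P} → Hard f (suc d) P → Hard f d P
hard-pred zero    h       = tt
hard-pred (suc d) (w , h) = w , λ v → let (b , h′) = h v in b , hard-pred d h′

hard-not : ∀ {f : (V → Bool) → Bool} d {P} → Hard f d P → Hard (not ∘ f) d P
hard-not zero    h       = tt
hard-not (suc d) (w , h) =
  (λ b → let (α , e , i) = w (not b) in α , trans (cong not e) (not-involutive b) , i) ,
  (λ v → let (b , h′) = h v in b , hard-not d h′)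

-- Once a conjunct has used up its queries, the adversary makes it true.
Keep : ((V → Bool) → Bool) → ℕ → ((V → Bool) → Set) → Set
Keep f zero    P = ∃ λ α → f α ≡ true × P ∋ α
Keep f (suc d) P = Hard f (suc d) P

keep-true : ∀ {f : (V → Bool) → Bool} d {P} → Keep f d P → ∃ λ α → f α ≡ true × P ∋ α
keep-true zero    k = k
keep-true (suc d) k = proj₁ k true

keep-query : ∀ {f : (V → Bool) → Bool} d {P} → Keep f d P → ∀ v →
  ∃ λ b → Keep f (pred d) (P ∩ v ≔ b)
keep-query zero          (α , e , i) v = α v , α , e , λ β β≗α → i β β≗α , β≗α v
-- The budget ends with this query, so the adversary commits here to an input with value true and
-- answers from it ever after.
keep-query (suc zero)    (w , h)     v =
  let (α , e , i) = w true in α v , α , e , λ β β≗α → i β β≗α , β≗α v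
keep-query (suc (suc d)) (w , h)     v = h v

both : ((V → Bool) → Bool) → (Bool × V → Bool) → Bool
both f α = f (λ v → α (false , v)) ∧ f (λ v → α (true , v))

join : (V → Bool) → (V → Bool) → Bool × V → Bool
join α β (false , v) = α v
join α β (true  , v) = β v

-- Budgets add up because a query is charged to its own conjunct alone. While `d + e` is positive,
-- some conjunct can still take the value false, and the other can always be completed to true.
hard-both : ∀ {f : (V → Bool) → Bool} n d e {P Q R} → n ≤ d + e → Keep f d P → Keep f e Q →
  (∀ γ → P (λ v → γ (false , v)) → Q (λ v → γ (true , v)) → R γ) → Hard (both f) n R
hard-both zero    d e n≤ k l P×Q⊆R = tt
hard-both {V} {f} (suc n) d e {P} {Q} {R} n≤ k l P×Q⊆R = witness , query
  where
  combine : ∀ {α β} → P ∋ α → Q ∋ β → R ∋ join α β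
  combine i j γ γ≗ = P×Q⊆R γ (i _ λ v → γ≗ (false , v)) (j _ λ v → γ≗ (true , v))

  false-witness : ∀ d e → suc n ≤ d + e → Keep f d P → Keep f e Q →
    ∃ λ γ → both f γ ≡ false × R ∋ γ
  false-witness (suc d) e _ k l =
    let (α , fα , i) = proj₁ k false
        (β , fβ , j) = keep-true e l
    in join α β , cong (_∧ f β) fα , combine i j
  false-witness zero (suc e) _ k l =
    let (α , fα , i) = k
        (β , fβ , j) = proj₁ l false
    in join α β , cong₂ _∧_ fα fβ , combine i j

  witness : ∀ b → ∃ λ γ → both f γ ≡ b × R ∋ γ
  witness true =
    let (α , fα , i) = keep-true d k
        (β , fβ , j) = keep-true e l
    in join α β , cong₂ _∧_ fα fβ , combine i j
  witness false = false-witness d e n≤ k l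

  pred-left : ∀ d → suc n ≤ d + e → n ≤ pred d + e
  pred-left zero    le = <⇒≤ le
  pred-left (suc d) le = s≤s⁻¹ le

  pred-right : ∀ e → suc n ≤ d + e → n ≤ d + pred e
  pred-right zero    le = <⇒≤ le
  pred-right (suc e) le = s≤s⁻¹ (subst (suc n ≤_) (+-suc d e) le)

  query : ∀ v → ∃ λ b → Hard (both f) n (R ∩ v ≔ b)
  query (false , v) =
    let (b , k′) = keep-query d k v in
    b , hard-both n (pred d) e (pred-left d n≤) k′ l λ γ (p , eq) q → P×Q⊆R γ p q , eq
  query (true , v) =
    let (b , l′) = keep-query e l v in
    b , hard-both n d (pred e) (pred-right e n≤) k l′ λ γ p (q , eq) → P×Q⊆R γ p q , eq

hard-keep : ∀ {f : (V → Bool) → Bool} d {P} → 0 < d → Hard f d P → Keep f d P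
hard-keep (suc d) _ h = h

-- Certificate systems and their conjunctions

byLabel : ℕ → ℕ → Bool → ℕ
byLabel t f b = if b then t else f

-- ver b reads the input together with an advice string on Adv; c₁ and c₀ bound
-- its cost, u₁ and u₀ that of the unambiguous certificates, and d is the depth.
record System (c₁ c₀ u₁ u₀ d : ℕ) : Set₁ where
  field
    Var Adv             : Set
    finite-Var        : Finite Var
    finite-Adv        : Finite Adv
    f               : (Var → Bool) → Bool
    partition       : Prog Var Bool
    partition-comp  : Computes partition f
    partition-cost  : Cost partition (byLabel u₁ u₀)
    ver             : Bool → Prog (Adv ⊎ Var) Bool
    accepts         : Bool → (Adv ⊎ Var → Bool) → Bool
    ver-comp        : ∀ b → Computes (ver b) (accepts b)
    ver-cost        : ∀ b → Cost (ver b) (λ _ → byLabel c₁ c₀ b)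
    sound           : ∀ b γ → accepts b γ ≡ true → f (λ v → γ (inj₂ v)) ≡ b
    complete        : ∀ b α → f α ≡ b → ∃ λ y → accepts b [ y , α ]′ ≡ true
    hard            : Hard f d (λ _ → ⊤)
    positive        : 0 < d

xnor-sound : ∀ b x → not (b xor x) ≡ true → x ≡ b
xnor-sound false false e = refl
xnor-sound true  true  e = refl

xnor-refl : ∀ b → not (b xor b) ≡ true
xnor-refl false = refl
xnor-refl true  = refl

bit : System 1 1 1 1 1
bit = record
  { Var = ⊤ ; Adv = ⊥
  ; finite-Var = tt ∷ [] , λ _ → here refl
  ; finite-Adv = [] , λ ()
  ; f = λ α → α tt
  ; partition = ask tt ret
  ; partition-comp = λ α → refl
  ; partition-cost = λ { false → ≤-refl ; true → ≤-refl }
  ; ver = λ b → ask (inj₂ tt) λ x → ret (not (b xor x))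
  ; accepts = λ b γ → not (b xor γ (inj₂ tt))
  ; ver-comp = λ b γ → refl
  ; ver-cost = λ { false _ → ≤-refl ; true _ → ≤-refl }
  ; sound = λ b γ → xnor-sound b (γ (inj₂ tt))
  ; complete = λ { b α refl → (λ ()) , xnor-refl (α tt) }
  ; hard = (λ b → (λ _ → b) , refl , λ _ _ → tt) , λ v → true , tt
  ; positive = s≤s z≤n
  }

negate : ∀ {c₁ c₀ u₁ u₀ d} → System c₁ c₀ u₁ u₀ d → System c₀ c₁ u₀ u₁ d
negate A = record
  { Var = Var ; Adv = Adv ; finite-Var = finite-Var ; finite-Adv = finite-Adv
  ; f = not ∘ f
  ; partition = partition >>= ret ∘ not
  ; partition-comp = bind-computes {p = partition} partition-comp λ x α → refl
  ; partition-cost = within-bind partition partition-cost λ { false → ≤-refl ; true → ≤-refl }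
  ; ver = ver ∘ not
  ; accepts = accepts ∘ not
  ; ver-comp = ver-comp ∘ not
  ; ver-cost = λ { false → ver-cost true ; true → ver-cost false }
  ; sound = λ b γ e → trans (cong not (sound (not b) γ e)) (not-involutive b)
  ; complete = λ b α e → complete (not b) α (trans (sym (not-involutive _)) (cong not e))
  ; hard = hard-not _ hard
  ; positive = positive
  }
  where open System A

weaken : ∀ {c₁ c₀ u₁ u₀ c₁′ c₀′ u₁′ u₀′ d} → c₁ ≤ c₁′ → c₀ ≤ c₀′ → u₁ ≤ u₁′ → u₀ ≤ u₀′ →
  System c₁ c₀ u₁ u₀ d → System c₁′ c₀′ u₁′ u₀′ d
weaken p q r s A = record
  { Var = Var ; Adv = Adv ; finite-Var = finite-Var ; finite-Adv = finite-Adv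
  ; f = f
  ; partition = partition
  ; partition-comp = partition-comp
  ; partition-cost = within-mono partition ≤-refl (λ { false → s ; true → r }) partition-cost
  ; ver = ver
  ; accepts = accepts
  ; ver-comp = ver-comp
  ; ver-cost = λ { false → within-mono (ver false) ≤-refl (λ _ → q) (ver-cost false)
                 ; true  → within-mono (ver true)  ≤-refl (λ _ → p) (ver-cost true) }
  ; sound = sound
  ; complete = complete
  ; hard = hard
  ; positive = positive
  }
  where open System A

∧-true : ∀ {a b} → a ∧ b ≡ true → a ≡ true × b ≡ true
∧-true {true} {true} e = refl , refl

-- The partition reads the second conjunct only after the first has proved true, so the value 0 pays
-- for a single 0-certificate. For `ver`, one advice bit, the entry `nothing`, names a false
-- conjunct: hence `suc c₀`.
conjoin : ∀ {c₁ c₀ u₁ u₀ d} → System c₁ c₀ u₁ u₀ d →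
  System (c₁ + c₁) (suc c₀) (u₁ + u₁) (u₁ + u₀) (d + d)
conjoin {c₁} {c₀} {u₁} {u₀} {d} A = record
  { Var = Bool × Var ; Adv = Maybe (Bool × Adv)
  ; finite-Var = finite-× finite-Bool finite-Var
  ; finite-Adv = finite-Maybe (finite-× finite-Bool finite-Adv)
  ; f = both f
  ; partition = on false >>= λ x → if x then on true else ret false
  ; partition-comp = bind-computes {p = on false}
      {g = λ x α → x ∧ f (λ v → α (true , v))} (on-comp false) λ { false α → refl ; true → on-comp true }
  ; partition-cost = within-bind (on false) (on-cost false) λ
      { false → m≤n+m u₀ u₁
      ; true  → cost-from u₁ (on true) (on-cost true) λ
          { false → ≤-reflexive (+-comm u₀ u₁) ; true → ≤-refl } }
  ; ver = ver₂
  ; accepts = accepts₂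
  ; ver-comp = ver₂-comp
  ; ver-cost = ver₂-cost
  ; sound = sound₂
  ; complete = complete₂
  ; hard = hard-both (d + d) d d {P = λ _ → ⊤} {Q = λ _ → ⊤} ≤-refl
      (hard-keep d positive hard) (hard-keep d positive hard) λ _ _ _ → tt
  ; positive = ≤-trans positive (m≤m+n d d)
  }
  where
  open System A
  on : Bool → Prog (Bool × Var) Bool
  on s = rename (s ,_) partition

  on-comp : ∀ s → Computes (on s) (λ α → f (λ v → α (s , v)))
  on-comp s = rename-computes (s ,_) partition partition-comp

  on-cost : ∀ s → Cost (on s) (byLabel u₁ u₀)
  on-cost s = rename-cost (s ,_) partition partition-cost

  side : Bool → Adv ⊎ Var → Maybe (Bool × Adv) ⊎ (Bool × Var)
  side s (inj₁ x) = inj₁ (just (s , x))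
  side s (inj₂ v) = inj₂ (s , v)

  check : Bool → Bool → Prog (Maybe (Bool × Adv) ⊎ (Bool × Var)) Bool
  check s b = rename (side s) (ver b)

  check-comp : ∀ s b → Computes (check s b) (λ γ → accepts b (γ ∘ side s))
  check-comp s b = rename-computes (side s) (ver b) (ver-comp b)

  check-cost : ∀ s b → Cost (check s b) (λ _ → byLabel c₁ c₀ b)
  check-cost s b = rename-cost (side s) (ver b) (ver-cost b)

  ver₂ : Bool → Prog (Maybe (Bool × Adv) ⊎ (Bool × Var)) Bool
  ver₂ true  = check false true >>= λ x → if x then check true true else ret false
  ver₂ false = ask (inj₁ nothing) λ s → check s false

  accepts₂ : Bool → (Maybe (Bool × Adv) ⊎ (Bool × Var) → Bool) → Bool
  accepts₂ true  γ = accepts true (γ ∘ side false) ∧ accepts true (γ ∘ side true)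
  accepts₂ false γ = accepts false (γ ∘ side (γ (inj₁ nothing)))

  ver₂-comp : ∀ b → Computes (ver₂ b) (accepts₂ b)
  ver₂-comp true = bind-computes {p = check false true}
    {g = λ x γ → x ∧ accepts true (γ ∘ side true)} (check-comp false true) λ { false γ → refl ; true → check-comp true true }
  ver₂-comp false γ = check-comp (γ (inj₁ nothing)) false γ

  ver₂-cost : ∀ b → Cost (ver₂ b) (λ _ → byLabel (c₁ + c₁) (suc c₀) b)
  ver₂-cost true = within-bind (check false true) (check-cost false true) λ
    { false → m≤m+n c₁ c₁ ; true → cost-from c₁ (check true true) (check-cost true true) λ _ → ≤-refl }
  ver₂-cost false s = cost-from 1 (check s false) (check-cost s false) λ _ → ≤-reflexive (+-comm c₀ 1)

  sound₂ : ∀ b γ → accepts₂ b γ ≡ true → both f (λ v → γ (inj₂ v)) ≡ b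
  sound₂ true γ e = let (p , q) = ∧-true e in cong₂ _∧_ (sound true _ p) (sound true _ q)
  sound₂ false γ e = falsify (γ (inj₁ nothing)) (sound false _ e)
    where
    falsify : ∀ s → f (λ v → γ (inj₂ (s , v))) ≡ false → both f (λ v → γ (inj₂ v)) ≡ false
    falsify false e = cong (_∧ f (λ v → γ (inj₂ (true , v)))) e
    falsify true  e with f (λ v → γ (inj₂ (false , v)))
    ... | false = refl
    ... | true  = e

  advice : Bool → (Bool → Adv → Bool) → Maybe (Bool × Adv) → Bool
  advice s y nothing        = s
  advice s y (just (t , x)) = y t x

  accepts-side : ∀ b s t y (α : Bool × Var → Bool) →
    accepts b [ y s , (λ v → α (s , v)) ]′ ≡ true →
    accepts b ([ advice t y , α ]′ ∘ side s) ≡ true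
  accepts-side b s t y α e =
    trans (computes-ext {p = ver b} (ver-comp b) λ { (inj₁ x) → refl ; (inj₂ v) → refl }) e

  complete₂ : ∀ b α → both f α ≡ b → ∃ λ y → accepts₂ b [ y , α ]′ ≡ true
  complete₂ true α e =
    let (p , q) = ∧-true e
        (y , a) = complete true _ p
        (z , b) = complete true _ q
        w       = λ s → if s then z else y
    in advice false w , cong₂ _∧_ (accepts-side true false false w α a) (accepts-side true true false w α b)
  complete₂ false α e with f (λ v → α (false , v)) in e₀
  ... | false = let (y , a) = complete false _ e₀ in
        advice false (λ _ → y) , accepts-side false false false (λ _ → y) α a
  ... | true = let (y , a) = complete false _ e in
        advice true (λ _ → y) , accepts-side false true true (λ _ → y) α a

-- Cheat sheets

every : ∀ {n} → Vec Bool n → Bool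
every []       = true
every (b ∷ bs) = b ∧ every bs

every-intro : ∀ {n} {φ : Fin n → Bool} → (∀ i → φ i ≡ true) → every (tabulate φ) ≡ true
every-intro {zero}  h = refl
every-intro {suc n} h = cong₂ _∧_ (h zero) (every-intro (h ∘ suc))

every-elim : ∀ {n} {φ : Fin n → Bool} → every (tabulate φ) ≡ true → ∀ i → φ i ≡ true
every-elim h zero    = proj₁ (∧-true h)
every-elim {φ = φ} h (suc i) = every-elim (proj₂ (∧-true {φ zero} h)) i

tails : ∀ {c} → Bool → List (Vec Bool (suc c)) → List (Vec Bool c)
tails b []             = []
tails false ((false ∷ v) ∷ T) = v ∷ tails false T
tails false ((true  ∷ v) ∷ T) = tails false T
tails true  ((false ∷ v) ∷ T) = tails true T
tails true  ((true  ∷ v) ∷ T) = v ∷ tails true T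

∈-tails : ∀ {c} b {v : Vec Bool c} {T} → (b ∷ v) ∈ T → v ∈ tails b T
∈-tails false (here refl) = here refl
∈-tails true  (here refl) = here refl
∈-tails false {T = (false ∷ _) ∷ _} (there m) = there (∈-tails false m)
∈-tails false {T = (true  ∷ _) ∷ _} (there m) = ∈-tails false m
∈-tails true  {T = (false ∷ _) ∷ _} (there m) = ∈-tails true m
∈-tails true  {T = (true  ∷ _) ∷ _} (there m) = there (∈-tails true m)

length-tails : ∀ {c} (T : List (Vec Bool (suc c))) →
  length (tails false T) + length (tails true T) ≡ length T
length-tails []                = refl
length-tails ((false ∷ v) ∷ T) = cong suc (length-tails T)
length-tails ((true  ∷ v) ∷ T) = trans (+-suc _ _) (cong suc (length-tails T))

-- Pigeonhole by halving the cube: the two lists of tails have total length `length T`, so one of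
-- them is shorter than `2 ^ c`.
unlisted : ∀ c (T : List (Vec Bool c)) → length T < 2 ^ c → ∃ λ ℓ → ℓ ∉ T
unlisted zero    []      _        = [] , λ ()
unlisted zero    (_ ∷ _) (s≤s ())
unlisted (suc c) T       lt with length (tails false T) <? 2 ^ c
... | yes lt₀ = let (ℓ , ∉) = unlisted c _ lt₀ in (false ∷ ℓ) , ∉ ∘ ∈-tails false
... | no  ge₀ = let (ℓ , ∉) = unlisted c _ lt₁ in (true ∷ ℓ) , ∉ ∘ ∈-tails true
  where
  open ≤-Reasoning
  lt₁ : length (tails true T) < 2 ^ c
  lt₁ = +-cancelˡ-< (2 ^ c) _ _ (begin-strict
    2 ^ c + length (tails true T)                    ≤⟨ +-monoˡ-≤ _ (≮⇒≥ ge₀) ⟩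
    length (tails false T) + length (tails true T)   ≡⟨ length-tails T ⟩
    length T                                         <⟨ lt ⟩
    2 ^ c + (2 ^ c + 0)                              ≡⟨ cong (2 ^ c +_) (+-identityʳ _) ⟩
    2 ^ c + 2 ^ c                                    ∎)

module CheatSheet (c : ℕ) {a u d : ℕ} (d≤2^c : d ≤ 2 ^ c) (A : System a a u u d) where
  open System A

  -- The entry `nothing` of a cell is a flag that has to be true. It makes an all-false cell
  -- invalid, even if all-false advice happens to be accepted.
  Sheet SheetAdv : Set
  Sheet    = (Fin c × Var) ⊎ (Vec Bool c × Maybe (Fin c × Adv))
  SheetAdv = Fin c ⊎ (Fin c × Adv)

  cell : Vec Bool c → Fin c → Adv ⊎ Var → Sheet
  cell ℓ i (inj₁ s) = inj₂ (ℓ , just (i , s))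
  cell ℓ i (inj₂ v) = inj₁ (i , v)

  claim : Fin c → Adv ⊎ Var → SheetAdv ⊎ Sheet
  claim i (inj₁ s) = inj₁ (inj₂ (i , s))
  claim i (inj₂ v) = inj₂ (inj₁ (i , v))

  ver-cost′ : ∀ b → Cost (ver b) (λ _ → a)
  ver-cost′ false = ver-cost false
  ver-cost′ true  = ver-cost true

  -- The same verification runs on two sources of advice: a cell of the sheet, through `cell ℓ`, and
  -- the advice string of the new system, through `claim`.
  module _ (ρ : Fin c → Adv ⊎ Var → W) where
    verAll : Vec Bool c → Prog W Bool
    verAll ℓ = sequence c (λ i → rename (ρ i) (ver (lookup ℓ i))) >>= λ bs → ret (every bs)

    acceptAll : Vec Bool c → (W → Bool) → Bool
    acceptAll ℓ γ = every (tabulate λ i → accepts (lookup ℓ i) (γ ∘ ρ i))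

    verAll-comp : ∀ ℓ → Computes (verAll ℓ) (acceptAll ℓ)
    verAll-comp ℓ = bind-computes {p = sequence c λ i → rename (ρ i) (ver (lookup ℓ i))}
      (sequence-computes c λ i → rename-computes (ρ i) (ver (lookup ℓ i)) (ver-comp (lookup ℓ i)))
      λ bs γ → refl

    verAll-cost : ∀ ℓ → Cost (verAll ℓ) (λ _ → c * a)
    verAll-cost ℓ = within-bind (sequence c λ i → rename (ρ i) (ver (lookup ℓ i)))
      (sequence-cost c λ i → rename-cost (ρ i) (ver (lookup ℓ i)) (ver-cost′ (lookup ℓ i)))
      λ bs → ≤-refl

    acceptAll-sound : ∀ ℓ γ → acceptAll ℓ γ ≡ true →
      tabulate (λ i → f (λ v → γ (ρ i (inj₂ v)))) ≡ ℓ
    acceptAll-sound ℓ γ e =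
      trans (tabulate-cong λ i → sound (lookup ℓ i) (γ ∘ ρ i) (every-elim e i)) (tabulate∘lookup ℓ)

  copy : (Sheet → Bool) → Fin c → Var → Bool
  copy γ i v = γ (inj₁ (i , v))

  address : (Sheet → Bool) → Vec Bool c
  address γ = tabulate λ i → f (copy γ i)

  readAddress : Prog Sheet (Vec Bool c)
  readAddress = sequence c λ i → rename (λ v → inj₁ (i , v)) partition

  readAddress-comp : Computes readAddress address
  readAddress-comp = sequence-computes c λ i → rename-computes (λ v → inj₁ (i , v)) partition partition-comp

  readAddress-cost : Cost readAddress (λ _ → c * u)
  readAddress-cost = sequence-cost c λ i → rename-cost (λ v → inj₁ (i , v)) partition
    (within-mono partition ≤-refl (λ { false → ≤-refl ; true → ≤-refl }) partition-cost)

  check : Vec Bool c → Prog Sheet Bool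
  check ℓ = ask (inj₂ (ℓ , nothing)) λ b → if b then verAll (cell ℓ) ℓ else ret false

  valid : Vec Bool c → (Sheet → Bool) → Bool
  valid ℓ γ = γ (inj₂ (ℓ , nothing)) ∧ acceptAll (cell ℓ) ℓ γ

  check-comp : ∀ ℓ → Computes (check ℓ) (valid ℓ)
  check-comp ℓ γ with γ (inj₂ (ℓ , nothing))
  ... | false = refl
  ... | true  = verAll-comp (cell ℓ) ℓ γ

  check-cost : ∀ ℓ → Cost (check ℓ) (λ _ → suc (c * a))
  check-cost ℓ false = s≤s z≤n
  check-cost ℓ true  = cost-from 1 (verAll (cell ℓ) ℓ) (verAll-cost (cell ℓ) ℓ) λ _ → ≤-reflexive (+-comm (c * a) 1)

  -- The certificates in a valid cell prove the values of the copies, that is, the address. So at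
  -- most one cell is valid, and guessing it is unambiguous.
  valid-address : ∀ ℓ γ → valid ℓ γ ≡ true → address γ ≡ ℓ
  valid-address ℓ γ e = acceptAll-sound (cell ℓ) ℓ γ (proj₂ (∧-true {γ (inj₂ (ℓ , nothing))} e))

  sheet : (Sheet → Bool) → Bool
  sheet γ = valid (address γ) γ

  onlyIf : Bool → Bool → Prog Sheet Bool
  onlyIf false false = ret false
  onlyIf true  true  = ret true
  onlyIf _     _     = fail

  -- The argument is a guessed label. For the label true, guessing the cell avoids the partition of
  -- `f`, so `u` is not paid; for false, the address must be found by reading all copies.
  parts : Bool → Prog Sheet Bool
  parts true  = guessVec c λ ℓ → check ℓ >>= onlyIf true
  parts false = readAddress >>= λ ℓ → check ℓ >>= onlyIf false

  check-outcome : ∀ b ℓ γ {x} → valid ℓ γ ≡ x →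
    outcomes (check ℓ >>= onlyIf b) γ ≡ outcomes (onlyIf b x) γ
  check-outcome b ℓ γ refl = outcomes-bind (check ℓ) γ (check-comp ℓ γ)

  outcomes-true : ∀ γ → outcomes (parts true) γ ≡ outcomes (onlyIf true (sheet γ)) γ
  outcomes-true γ = trans
    (guessVec-only c (address γ) λ ℓ ℓ≢ → check-outcome true ℓ γ (invalid ℓ ℓ≢))
    (check-outcome true (address γ) γ refl)
    where
    invalid : ∀ ℓ → ℓ ≢ address γ → valid ℓ γ ≡ false
    invalid ℓ ℓ≢ with valid ℓ γ in e
    ... | false = refl
    ... | true  = contradiction (sym (valid-address ℓ γ e)) ℓ≢

  outcomes-false : ∀ γ → outcomes (parts false) γ ≡ outcomes (onlyIf false (sheet γ)) γ
  outcomes-false γ = trans (outcomes-bind readAddress γ (readAddress-comp γ))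
    (check-outcome false (address γ) γ refl)

  parts-comp : Computes (guess parts) sheet
  parts-comp γ = trans (cong₂ _++_ (outcomes-false γ) (outcomes-true γ)) (merge (sheet γ))
    where
    merge : ∀ b → outcomes (onlyIf false b) γ ++ outcomes (onlyIf true b) γ ≡ [ b ]
    merge false = refl
    merge true  = refl

  onlyIf-within : ∀ {n} {B : Bool → ℕ} b x → n ≤ B b → Within n (onlyIf b x) B
  onlyIf-within false false h = h
  onlyIf-within false true  h = tt
  onlyIf-within true  false h = tt
  onlyIf-within true  true  h = h

  parts-cost : Cost (guess parts) (byLabel (2 + (c * a + c)) (2 + (c * a + c * u)))
  parts-cost true = guessVec-within c λ ℓ →
    within-bind (check ℓ) (cost-from (c + 1) (check ℓ) (check-cost ℓ) λ _ → ≤-refl) λ x →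
      onlyIf-within true x (≤-reflexive (cong suc
        (trans (sym (+-assoc (c * a) c 1)) (+-comm _ 1))))
  parts-cost false =
    within-bind readAddress
      (cost-from 1 readAddress {C = λ _ → c * u + 1} readAddress-cost λ _ → ≤-refl) λ ℓ →
    within-bind (check ℓ) (cost-from (c * u + 1) (check ℓ) (check-cost ℓ) λ _ → ≤-refl) λ x →
      onlyIf-within false x (≤-reflexive (cong suc
        (trans (sym (+-assoc (c * a) (c * u) 1)) (+-comm _ 1))))

  readClaim : Prog (SheetAdv ⊎ Sheet) (Vec Bool c)
  readClaim = sequence c λ i → ask (inj₁ (inj₁ i)) ret

  confirm : Bool → Vec Bool c → Prog (SheetAdv ⊎ Sheet) Bool
  confirm b ℓ = rename inj₂ (check ℓ) >>= λ x → ret (not (b xor x))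

  -- Ambiguous certificates avoid `u` for both values: the advice claims an address and certifies
  -- it, after which a single cell decides.
  verSheet : Bool → Prog (SheetAdv ⊎ Sheet) Bool
  verSheet b = readClaim >>= λ ℓ → verAll claim ℓ >>= λ x → if x then confirm b ℓ else ret false

  acceptSheet : Bool → (SheetAdv ⊎ Sheet → Bool) → Bool
  acceptSheet b γ = let ℓ = tabulate (λ i → γ (inj₁ (inj₁ i))) in
    acceptAll claim ℓ γ ∧ not (b xor valid ℓ (γ ∘ inj₂))

  verSheet-comp : ∀ b → Computes (verSheet b) (acceptSheet b)
  verSheet-comp b = bind-computes {p = readClaim}
    {g = λ ℓ γ → acceptAll claim ℓ γ ∧ not (b xor valid ℓ (γ ∘ inj₂))}
    (sequence-computes c λ i γ → refl) λ ℓ →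
    bind-computes {p = verAll claim ℓ} {g = λ x γ → x ∧ not (b xor valid ℓ (γ ∘ inj₂))}
    (verAll-comp claim ℓ) λ
      { false γ → refl
      ; true → bind-computes {p = rename inj₂ (check ℓ)}
          (rename-computes inj₂ (check ℓ) (check-comp ℓ)) λ x γ → refl }

  verSheet-cost : ∀ b → Cost (verSheet b) (λ _ → suc (c * a + (c * a + c)))
  verSheet-cost b =
    within-bind readClaim (sequence-cost c {w = 1} λ i b → ≤-refl) λ ℓ →
    within-bind (verAll claim ℓ) {B = λ _ → c * a + c}
      (cost-from (c * 1) (verAll claim ℓ) (verAll-cost claim ℓ)
        λ _ → +-monoʳ-≤ (c * a) (≤-reflexive (*-identityʳ c))) λ
      { false → ≤-trans (m≤n+m _ (c * a)) (n≤1+n _)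
      ; true → within-bind (rename inj₂ (check ℓ))
          (cost-from (c * a + c) (rename inj₂ (check ℓ)) (rename-cost inj₂ (check ℓ) (check-cost ℓ))
            λ _ → ≤-refl) λ _ → ≤-refl }

  sound-sheet : ∀ b γ → acceptSheet b γ ≡ true → sheet (γ ∘ inj₂) ≡ b
  sound-sheet b γ e =
    let ℓ = tabulate (λ i → γ (inj₁ (inj₁ i)))
        (p , q) = ∧-true {acceptAll claim ℓ γ} e
    in trans (cong (λ ℓ′ → valid ℓ′ (γ ∘ inj₂)) (acceptAll-sound claim ℓ γ p)) (xnor-sound b _ q)

  acceptAll-complete : (ρ : Fin c → Adv ⊎ Var → W) (γ : W → Bool) (ℓ : Vec Bool c)
    (y : Fin c → Adv → Bool) →
    (∀ i → accepts (lookup ℓ i) [ y i , (λ v → γ (ρ i (inj₂ v))) ]′ ≡ true) →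
    (∀ i s → γ (ρ i (inj₁ s)) ≡ y i s) → acceptAll ρ ℓ γ ≡ true
  acceptAll-complete ρ γ ℓ y certified adv = every-intro λ i → trans
    (computes-ext {p = ver (lookup ℓ i)} (ver-comp (lookup ℓ i))
      λ { (inj₁ s) → adv i s ; (inj₂ v) → refl })
    (certified i)

  complete-sheet : ∀ b α → sheet α ≡ b → ∃ λ y → acceptSheet b [ y , α ]′ ≡ true
  complete-sheet b α refl =
    y , cong₂ _∧_
      (acceptAll-complete claim [ y , α ]′ (address α) (λ i → proj₁ (cert i)) (λ i → proj₂ (cert i))
        λ i s → refl)
      (xnor-refl b)
    where
    cert : ∀ i → ∃ λ y → accepts (lookup (address α) i) [ y , copy α i ]′ ≡ true
    cert i = complete (lookup (address α) i) (copy α i) (sym (lookup∘tabulate _ i))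

    y : SheetAdv → Bool
    y (inj₁ i)       = f (copy α i)
    y (inj₂ (i , s)) = proj₁ (cert i) s

  restrict : (Fin c → (Var → Bool) → Set) → Fin c → Var → Bool → Fin c → (Var → Bool) → Set
  restrict P i v b j α = P j α × (j ≡ i → α v ≡ b)

  -- Queries to cells are answered false. As long as a cell is untouched and all
  -- the copies are undecided, the address can still be made to point to a cell
  -- holding the right certificates.
  hard-sheet : ∀ n (T : List (Vec Bool c)) {P : Fin c → (Var → Bool) → Set} {Q} →
    n + length T ≤ 2 ^ c → (∀ i → Hard f n (P i)) →
    (∀ γ → (∀ i → P i (copy γ i)) → (∀ ℓ → ℓ ∈ T → ∀ x → γ (inj₂ (ℓ , x)) ≡ false) → Q γ) →
    Hard sheet n Q
  hard-sheet zero    T n≤ h P⊆Q = tt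
  hard-sheet (suc n) T {P} {Q} n≤ h P⊆Q = witness , query
    where
    build : (α : Fin c → Var → Bool) (κ : Vec Bool c × Maybe (Fin c × Adv) → Bool) → Sheet → Bool
    build α κ (inj₁ (i , v)) = α i v
    build α κ (inj₂ x)       = κ x

    build-∋ : ∀ {α κ} → (∀ i → P i ∋ α i) → (∀ ℓ → ℓ ∈ T → ∀ x → κ (ℓ , x) ≡ false) →
      Q ∋ build α κ
    build-∋ p q β β≗ = P⊆Q β (λ i → p i _ λ v → β≗ (inj₁ (i , v)))
      λ ℓ ℓ∈T x → trans (β≗ (inj₂ (ℓ , x))) (q ℓ ℓ∈T x)

    witness : ∀ b → ∃ λ γ → sheet γ ≡ b × Q ∋ γ
    witness false =
      -- With all flags false no cell is valid, whatever the address.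
      build (λ i → proj₁ (proj₁ (h i) true)) (λ _ → false) , refl ,
      build-∋ (λ i → proj₂ (proj₂ (proj₁ (h i) true))) λ _ _ _ → refl
    witness true =
      γ , trans (cong (λ ℓ′ → valid ℓ′ γ) address-γ) valid-γ ,
      build-∋ (λ i → proj₂ (proj₂ (w i))) untouched
      where
      fresh : ∃ λ ℓ → ℓ ∉ T
      fresh = unlisted c T (≤-trans (s≤s (m≤n+m (length T) n)) n≤)

      ℓ : Vec Bool c
      ℓ = proj₁ fresh

      w : ∀ i → ∃ λ α → f α ≡ lookup ℓ i × P i ∋ α
      w i = proj₁ (h i) (lookup ℓ i)

      cert : ∀ i → ∃ λ y → accepts (lookup ℓ i) [ y , proj₁ (w i) ]′ ≡ true
      cert i = complete (lookup ℓ i) (proj₁ (w i)) (proj₁ (proj₂ (w i)))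

      content : Maybe (Fin c × Adv) → Bool
      content nothing        = true
      content (just (i , s)) = proj₁ (cert i) s

      κ : Vec Bool c × Maybe (Fin c × Adv) → Bool
      κ (ℓ′ , x) = if does (≡-dec Bool._≟_ ℓ′ ℓ) then content x else false

      γ : Sheet → Bool
      γ = build (λ i → proj₁ (w i)) κ

      κ-ℓ : ∀ x → κ (ℓ , x) ≡ content x
      κ-ℓ x rewrite dec-true (≡-dec Bool._≟_ ℓ ℓ) refl = refl

      untouched : ∀ ℓ′ → ℓ′ ∈ T → ∀ x → κ (ℓ′ , x) ≡ false
      untouched ℓ′ ℓ′∈T x
        rewrite dec-false (≡-dec Bool._≟_ ℓ′ ℓ) (λ { refl → proj₂ fresh ℓ′∈T }) = refl

      address-γ : address γ ≡ ℓ
      address-γ = trans (tabulate-cong λ i → proj₁ (proj₂ (w i))) (tabulate∘lookup ℓ)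

      valid-γ : valid ℓ γ ≡ true
      valid-γ = cong₂ _∧_ (κ-ℓ nothing)
        (acceptAll-complete (cell ℓ) γ ℓ (λ i → proj₁ (cert i)) (λ i → proj₂ (cert i))
          λ i s → κ-ℓ (just (i , s)))

    query : ∀ x → ∃ λ b → Hard sheet n (Q ∩ x ≔ b)
    query (inj₁ (i , v)) =
      let (b , hᵢ) = proj₂ (h i) v in b ,
      hard-sheet n T {restrict P i v b} (<⇒≤ n≤) (restricted b hᵢ)
        λ γ p t → P⊆Q γ (λ j → proj₁ (p j)) t , proj₂ (p i) refl
      where
      restricted : ∀ b → Hard f n (P i ∩ v ≔ b) → ∀ j → Hard f n (restrict P i v b j)
      restricted b hᵢ j with j Fin.≟ i
      ... | yes refl = hard-mono n (λ α (p , e) → p , λ _ → e) hᵢ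
      ... | no  j≢i  = hard-mono n (λ α p → p , λ j≡i → contradiction j≡i j≢i) (hard-pred n (h j))
    -- `n` loses one and `T` gains the touched cell, so `n + length T` stays bounded by the number
    -- of cells.
    query (inj₂ (ℓ , x)) = false ,
      hard-sheet n (ℓ ∷ T) (≤-trans (≤-reflexive (+-suc n (length T))) n≤)
        (λ i → hard-pred n (h i))
        λ γ p t → P⊆Q γ p (λ ℓ′ m → t ℓ′ (there m)) , t ℓ (here refl) x

  cheatSheet : System (suc (c * a + (c * a + c))) (suc (c * a + (c * a + c)))
                      (2 + (c * a + c)) (2 + (c * a + c * u)) d
  cheatSheet = record
    { Var = Sheet ; Adv = SheetAdv
    ; finite-Var = finite-⊎ (finite-× (finite-Fin c) finite-Var)
        (finite-× (finite-Vec c) (finite-Maybe (finite-× (finite-Fin c) finite-Adv)))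
    ; finite-Adv = finite-⊎ (finite-Fin c) (finite-× (finite-Fin c) finite-Adv)
    ; f = sheet
    ; partition = guess parts
    ; partition-comp = parts-comp
    ; partition-cost = parts-cost
    ; ver = verSheet
    ; accepts = acceptSheet
    ; ver-comp = verSheet-comp
    ; ver-cost = λ { false → verSheet-cost false ; true → verSheet-cost true }
    ; sound = sound-sheet
    ; complete = complete-sheet
    ; hard = hard-sheet d [] {P = λ _ _ → ⊤} (subst (_≤ 2 ^ c) (sym (+-identityʳ d)) d≤2^c)
        (λ _ → hard) λ _ _ _ → tt
    ; positive = positive
    }

-- Iterated rounds

1≤2^ : ∀ n → 1 ≤ 2 ^ n
1≤2^ = m^n>0 2

2^suc* : ∀ r x → 2 ^ suc r * x ≡ 2 ^ r * x + 2 ^ r * x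
2^suc* r x = trans (cong (_* x) (cong (2 ^ r +_) (+-identityʳ (2 ^ r)))) (*-distribʳ-+ x (2 ^ r) (2 ^ r))

-- The term `u₀` is not multiplied: of all the conjuncts read, only the last is false. Writing
-- `2 ^ r * u₁` for (2 ^ r - 1) u₁ avoids subtraction.
conjoins : ∀ r {c₁ c₀ u₁ u₀ d} → System c₁ c₀ u₁ (u₁ + u₀) d →
  System (2 ^ r * c₁) (r + c₀) (2 ^ r * u₁) (2 ^ r * u₁ + u₀) (2 ^ r * d)
conjoins zero {c₁} {c₀} {u₁} {u₀} {d} A =
  subst (System _ _ _ _) (sym (*-identityˡ d))
    (weaken (≤-reflexive (sym (*-identityˡ c₁))) ≤-refl (≤-reflexive (sym (*-identityˡ u₁)))
      (≤-reflexive (cong (_+ u₀) (sym (*-identityˡ u₁)))) A)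
conjoins (suc r) {c₁} {c₀} {u₁} {u₀} {d} A =
  subst (System _ _ _ _) (sym (2^suc* r d))
    (weaken (≤-reflexive (sym (2^suc* r c₁))) ≤-refl (≤-reflexive (sym (2^suc* r u₁)))
      (≤-reflexive (trans (sym (+-assoc (2 ^ r * u₁) _ u₀)) (cong (_+ u₀) (sym (2^suc* r u₁)))))
      (conjoin (conjoins r A)))

-- One round: a cheat sheet for OR_N ∘ AND_N with N = 2 ^ r.
round : ∀ r c {a u d} → 2 ^ r * (2 ^ r * d) ≤ 2 ^ c → System a a a u d →
  let A = 2 ^ r * (r + a); U = 2 ^ r * (2 ^ r * a + u) + 2 ^ r * a in
  System (suc (c * A + (c * A + c))) (suc (c * A + (c * A + c)))
         (2 + (c * A + c)) (2 + (c * A + c * U)) (2 ^ r * (2 ^ r * d))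
round r c {a} {u} d≤ A = CheatSheet.cheatSheet c d≤
  (weaken {c₁ = r + 2 ^ r * a} r+Na≤ ≤-refl ≤-refl (m≤m+n _ (2 ^ r * a))
    -- OR_N is AND_N between two negations: the inner `conjoins` is the AND, the outer one the OR.
    (negate (conjoins r (weaken ≤-refl ≤-refl ≤-refl (m≤n+m (2 ^ r * a) (2 ^ r * a + u))
      (negate (conjoins r (weaken ≤-refl ≤-refl ≤-refl (m≤n+m u a) A)))))))
  where
  r+Na≤ : r + 2 ^ r * a ≤ 2 ^ r * (r + a)
  r+Na≤ = ≤-trans (+-monoˡ-≤ (2 ^ r * a) (m≤n*m r (2 ^ r) {{m^n≢0 2 r}}))
    (≤-reflexive (sym (*-distribˡ-+ (2 ^ r) r a)))

-- Here a = Z and u = Z * N, and `X` dominates the logarithmic quantities `c` and `r`. The 7 is 2 +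
-- 2 + 3, from the three summands of the last and costliest bound.
round-bounds : ∀ N Z c r X → 1 ≤ N → 1 ≤ Z → c ≤ X → r ≤ X → 1 ≤ X →
  let A = N * (r + Z); U = N * (N * Z + Z * N) + N * Z; E = X * X * (N * Z) in
  suc (c * A + (c * A + c)) ≤ 7 * E × 2 + (c * A + c) ≤ 7 * E × 2 + (c * A + c * U) ≤ 7 * E * N
round-bounds N Z c r X 1≤N 1≤Z c≤X r≤X 1≤X =
  ≤-trans (+-mono-≤ 1≤E (+-mono-≤ cA≤ (+-mono-≤ cA≤ c≤E)))
    (≤-trans (≤-reflexive (solve 1 (λ e → e :+ (con 2 :* e :+ (con 2 :* e :+ e)) := con 6 :* e) refl E))
      (*-monoˡ-≤ E (m≤m+n 6 1))) ,
  ≤-trans (+-mono-≤ (*-monoʳ-≤ 2 1≤E) (+-mono-≤ cA≤ c≤E))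
    (≤-trans (≤-reflexive (solve 1 (λ e → con 2 :* e :+ (con 2 :* e :+ e) := con 5 :* e) refl E))
      (*-monoˡ-≤ E (m≤m+n 5 2))) ,
  ≤-trans (+-mono-≤ (*-monoʳ-≤ 2 (≤-trans 1≤E E≤EN)) (+-mono-≤ (≤-trans cA≤ (*-monoʳ-≤ 2 E≤EN)) cU≤))
    (≤-reflexive (solve 2 (λ e n → con 2 :* (e :* n) :+ (con 2 :* (e :* n) :+ con 3 :* (e :* n))
      := con 7 :* e :* n) refl E N))
  where
  open +-*-Solver
  open ≤-Reasoning
  E = X * X * (N * Z)
  A = N * (r + Z)
  U = N * (N * Z + Z * N) + N * Z

  Z≤XZ : Z ≤ X * Z
  Z≤XZ = ≤-trans (≤-reflexive (sym (*-identityˡ Z))) (*-monoˡ-≤ Z 1≤X)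

  X≤XZ : X ≤ X * Z
  X≤XZ = ≤-trans (≤-reflexive (sym (*-identityʳ X))) (*-monoʳ-≤ X 1≤Z)

  1≤E : 1 ≤ E
  1≤E = *-mono-≤ (*-mono-≤ 1≤X 1≤X) (*-mono-≤ 1≤N 1≤Z)

  X≤E : X ≤ E
  X≤E = begin
    X                   ≡⟨ solve 1 (λ x → x := x :* con 1 :* (con 1 :* con 1)) refl X ⟩
    X * 1 * (1 * 1)     ≤⟨ *-mono-≤ (*-monoʳ-≤ X 1≤X) (*-mono-≤ 1≤N 1≤Z) ⟩
    E                   ∎

  c≤E : c ≤ E
  c≤E = ≤-trans c≤X X≤E

  cA≤ : c * A ≤ 2 * E
  cA≤ = begin
    c * (N * (r + Z))           ≤⟨ *-mono-≤ c≤X (*-monoʳ-≤ N (+-mono-≤ (≤-trans r≤X X≤XZ) Z≤XZ)) ⟩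
    X * (N * (X * Z + X * Z))   ≡⟨ solve 3 (λ x n z → x :* (n :* (x :* z :+ x :* z)) :=
                                     con 2 :* (x :* x :* (n :* z))) refl X N Z ⟩
    2 * E                       ∎

  E≤EN : E ≤ E * N
  E≤EN = ≤-trans (≤-reflexive (sym (*-identityʳ E))) (*-monoʳ-≤ E 1≤N)

  cU≤ : c * U ≤ 3 * (E * N)
  cU≤ = begin
    c * U                                           ≤⟨ *-monoˡ-≤ U c≤X ⟩
    X * (N * (N * Z + Z * N) + N * Z)               ≡⟨ solve 3 (λ x n z → x :* (n :* (n :* z :+ z :* n) :+ n :* z) :=
                                                         con 2 :* (x :* con 1 :* (n :* z) :* n) :+ x :* con 1 :* (n :* z) :* con 1) refl X N Z ⟩
    2 * (X * 1 * (N * Z) * N) + X * 1 * (N * Z) * 1 ≤⟨ +-mono-≤ (*-monoʳ-≤ 2 (*-monoˡ-≤ N (*-monoˡ-≤ (N * Z) (*-monoʳ-≤ X 1≤X))))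
                                                         (*-mono-≤ (*-monoˡ-≤ (N * Z) (*-monoʳ-≤ X 1≤X)) 1≤N) ⟩
    2 * (E * N) + E * N                             ≡⟨ solve 1 (λ e → con 2 :* e :+ e := con 3 :* e) refl (E * N) ⟩
    3 * (E * N)                                     ∎

module Rounds (r k : ℕ) where
  N M : ℕ
  N = 2 ^ r
  M = suc (r * suc (2 * k))

  width-bound : ℕ → ℕ
  width-bound j = (7 * (M * M)) ^ j * N ^ j

  1≤width-bound : ∀ j → 1 ≤ width-bound j
  1≤width-bound j = *-mono-≤ (m^n>0 (7 * (M * M)) j) (m^n>0 N {{m^n≢0 2 r}} j)

  N^2suc : ∀ j → N * (N * N ^ (2 * j)) ≡ N ^ (2 * suc j)
  N^2suc j = cong (N ^_) (sym (*-suc 2 j))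

  -- Every round uses addresses of length `r * (2 * k)`, the logarithm of the final depth. This
  -- suffices for the smaller depths before it and lets one `M` serve all rounds.
  rounds : ∀ j → j ≤ k →
    let Z = width-bound j in System Z Z Z (Z * N) (N ^ (2 * j))
  rounds zero    _   = weaken ≤-refl ≤-refl ≤-refl (≤-trans (1≤2^ r) (≤-reflexive (sym (*-identityˡ N)))) bit
  rounds (suc j) j<k =
    let Z = width-bound j
        (p , q , s) = round-bounds N Z (r * (2 * k)) r M (1≤2^ r) (1≤width-bound j) c≤M r≤M (s≤s z≤n)
        e = eq Z ((7 * (M * M)) ^ j) (N ^ j) refl
    in subst (System _ _ _ _) (N^2suc j)
      (weaken (≤-trans p e) (≤-trans p e) (≤-trans q e) (≤-trans s (*-monoˡ-≤ N e))
        (round r (r * (2 * k)) d≤ (rounds j (<⇒≤ j<k))))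
    where
    open +-*-Solver
    open ≤-Reasoning
    c≤M : r * (2 * k) ≤ M
    c≤M = ≤-trans (*-monoʳ-≤ r (n≤1+n (2 * k))) (n≤1+n _)

    r≤M : r ≤ M
    r≤M = ≤-trans (m≤m*n r (suc (2 * k))) (n≤1+n _)

    d≤ : N * (N * N ^ (2 * j)) ≤ 2 ^ (r * (2 * k))
    d≤ = begin
      N * (N * N ^ (2 * j))  ≡⟨ N^2suc j ⟩
      N ^ (2 * suc j)        ≤⟨ ^-monoʳ-≤ N {{m^n≢0 2 r}} (*-monoʳ-≤ 2 j<k) ⟩
      N ^ (2 * k)            ≡⟨ ^-*-assoc 2 r (2 * k) ⟩
      2 ^ (r * (2 * k))      ∎

    eq : ∀ Z a b → Z ≡ a * b → 7 * (M * M * (N * Z)) ≤ (7 * (M * M) * a) * (N * b)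
    eq _ a b refl = ≤-reflexive (solve 4 (λ x n a b →
      con 7 :* (x :* x :* (n :* (a :* b))) := con 7 :* (x :* x) :* a :* (n :* b)) refl M N a b)

-- Lifting by majority

module Affinity {W : Set} (_≟_ : DecidableEquality W) where

  _[_≔_] : (W → Bool) → W → Bool → W → Bool
  (α [ w ≔ b ]) w′ = if does (w′ ≟ w) then b else α w′

  update-same : ∀ α w b → (α [ w ≔ b ]) w ≡ b
  update-same α w b rewrite dec-true (w ≟ w) refl = refl

  update-other : ∀ α w b {w′} → w′ ≢ w → (α [ w ≔ b ]) w′ ≡ α w′
  update-other α w b {w′} ne rewrite dec-false (w′ ≟ w) ne = refl

  -- Affinity is expressed by the effect of changing one coordinate, so closure under xor and
  -- substitution needs neither a normal form nor sums over `W`.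
  record Affine (h : (W → Bool) → Bool) : Set where
    field
      coefficient : W → Bool
      update      : ∀ w α b → h (α [ w ≔ b ]) ≡ h α xor (coefficient w ∧ (b xor α w))

  open Affine

  affine-≗ : ∀ {g h} → (∀ α → g α ≡ h α) → Affine g → Affine h
  affine-≗ e p .coefficient  = coefficient p
  affine-≗ e p .update w α b =
    trans (sym (e _)) (trans (update p w α b) (cong (_xor (coefficient p w ∧ (b xor α w))) (e α)))

  xor-falseʳ : ∀ a → a xor false ≡ a
  xor-falseʳ false = refl
  xor-falseʳ true  = refl

  affine-const : ∀ x → Affine (λ _ → x)
  affine-const x .coefficient  = λ _ → false
  affine-const x .update w α b = sym (xor-falseʳ x)

  xor-cancel : ∀ a b → b ≡ a xor (b xor a)
  xor-cancel = solve 2 (λ a b → b := a :+ (b :+ a)) refl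
    where open BoolSolver.xor-∧-Solver

  affine-coordinate : ∀ w′ → Affine (λ α → α w′)
  affine-coordinate w′ .coefficient w = does (w′ ≟ w)
  affine-coordinate w′ .update w α b with w′ ≟ w
  ... | yes refl = xor-cancel (α w′) b
  ... | no  _    = sym (xor-falseʳ (α w′))

  affine-xor : ∀ {g h} → Affine g → Affine h → Affine (λ α → g α xor h α)
  affine-xor p q .coefficient w = coefficient p w xor coefficient q w
  affine-xor {g} {h} p q .update w α b =
    trans (cong₂ _xor_ (update p w α b) (update q w α b))
      (rearrange (g α) (h α) (coefficient p w) (coefficient q w) (b xor α w))
    where
    open BoolSolver.xor-∧-Solver
    rearrange : ∀ x y c d t → (x xor (c ∧ t)) xor (y xor (d ∧ t)) ≡ (x xor y) xor ((c xor d) ∧ t)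
    rearrange = solve 5 (λ x y c d t → (x :+ c :* t) :+ (y :+ d :* t) := (x :+ y) :+ (c :+ d) :* t) refl

  affine-∧ : ∀ x {h} → Affine h → Affine (λ α → x ∧ h α)
  affine-∧ false p = affine-const false
  affine-∧ true  p = p

  affine-update : ∀ {h} w b → Affine h → Affine (λ α → h (α [ w ≔ b ]))
  affine-update w b p = affine-≗ (λ α → sym (update p w α b))
    (affine-xor p (affine-∧ (coefficient p w) (affine-xor (affine-const b) (affine-coordinate w))))

  affine-evalForm : ∀ {n} (I : LinForm n) {g : Fin n → (W → Bool) → Bool} →
    (∀ k → Affine (g k)) → Affine (λ α → evalForm I (λ k → g k α))
  affine-evalForm []      p = affine-const false
  affine-evalForm (x ∷ I) p = affine-xor (affine-∧ x (p zero)) (affine-evalForm I (p ∘ suc))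

  Extensional : ((W → Bool) → Bool) → Set
  Extensional h = ∀ {α β} → α ≗ β → h α ≡ h β

  -- `Affine` speaks of single changes only, so α is turned into β one coordinate of `xs` at a time.
  constant : ∀ {h} (a : Affine h) → Extensional h → (∀ w → coefficient a w ≡ false) →
    (xs : List W) → ∀ α β → (∀ w → w ∉ xs → α w ≡ β w) → h α ≡ h β
  constant a ext z []       α β agree = ext λ w → agree w λ ()
  constant {h} a ext z (w ∷ xs) α β agree =
    trans (sym unchanged) (constant a ext z xs (α [ w ≔ β w ]) β agree′)
    where
    unchanged : h (α [ w ≔ β w ]) ≡ h α
    unchanged = trans (update a w α (β w))
      (trans (cong (λ c → h α xor (c ∧ (β w xor α w))) (z w)) (xor-falseʳ (h α)))

    agree′ : ∀ w′ → w′ ∉ xs → (α [ w ≔ β w ]) w′ ≡ β w′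
    agree′ w′ ∉xs with w′ ≟ w
    ... | yes refl = refl
    ... | no  w′≢w = agree w′ λ { (here e) → w′≢w e ; (there m) → ∉xs m }

  pivot? : ∀ {h} (a : Affine h) → Finite W →
    (∃ λ w → coefficient a w ≡ true) ⊎ (∀ w → coefficient a w ≡ false)
  pivot? a (xs , enum) = search xs (λ w _ → enum w)
    where
    search : ∀ ys → (∀ w → coefficient a w ≡ true → w ∈ ys) →
      (∃ λ w → coefficient a w ≡ true) ⊎ (∀ w → coefficient a w ≡ false)
    search []       h = inj₂ λ w → none w (coefficient a w) refl
      where
      none : ∀ w b → coefficient a w ≡ b → b ≡ false
      none w false e = refl
      none w true  e with h w e
      ... | ()
    search (y ∷ ys) h with coefficient a y in e
    ... | true  = inj₁ (y , e)
    ... | false = search ys λ w e′ → rest w e′ (h w e′)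
      where
      rest : ∀ w → coefficient a w ≡ true → w ∈ (y ∷ ys) → w ∈ ys
      rest w e′ (there m) = m
      rest w e′ (here refl) with trans (sym e) e′
      ... | ()

maj : (Fin 3 → Bool) → Bool
maj φ = if φ zero xor φ (suc zero) then φ (suc (suc zero)) else φ zero

-- MAJ₃ is stifling: fixing the other two inputs of a block to b forces its
-- value to b and leaves input j free.
maj-stifled : ∀ φ j b → (∀ i → i ≢ j → φ i ≡ b) → maj φ ≡ b
maj-stifled φ zero b h
  rewrite h (suc zero) (λ ()) | h (suc (suc zero)) (λ ()) with φ zero | b
... | false | false = refl
... | false | true  = refl
... | true  | false = refl
... | true  | true  = refl
maj-stifled φ (suc zero) b h
  rewrite h zero (λ ()) | h (suc (suc zero)) (λ ()) with φ (suc zero) | b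
... | false | false = refl
... | false | true  = refl
... | true  | false = refl
... | true  | true  = refl
maj-stifled φ (suc (suc zero)) b h
  rewrite h zero (λ ()) | h (suc zero) (λ ()) with b
... | false = refl
... | true  = refl

maj-const : ∀ φ b → (∀ i → φ i ≡ b) → maj φ ≡ b
maj-const φ b h = maj-stifled φ zero b λ i _ → h i

blocks : (V × Fin 3 → Bool) → V → Bool
blocks α v = maj λ j → α (v , j)

module Lifting {V : Set} (_≟_ : DecidableEquality (V × Fin 3)) (finite : Finite (V × Fin 3))
  (_≟ᵛ_ : DecidableEquality V)
  {n : ℕ} (decode : Fin n → V × Fin 3)
  (g : (V → Bool) → Bool) (g-ext : ∀ {α β} → α ≗ β → g α ≡ g β) where

  open Affinity _≟_
  open Affine

  Var : Set
  Var = V × Fin 3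

  -- σ expresses the variables of the fixed blocks through those of the free ones.
  record Restriction (P : (V → Bool) → Set) : Set where
    field
      free     : V → Bool
      σ        : (Var → Bool) → Var → Bool
      affine   : ∀ w → Affine (λ α → σ α w)
      local    : ∀ {α β} → (∀ v j → free v ≡ true → α (v , j) ≡ β (v , j)) → σ α ≗ σ β
      identity : ∀ v → free v ≡ true → ∀ α j → σ α (v , j) ≡ α (v , j)
      fixed    : ∀ v → free v ≡ false → ∀ α z → P z → blocks (σ α) v ≡ z v

    eval : LinForm n → (Var → Bool) → Bool
    eval I α = evalForm I (λ k → σ α (decode k))

    eval-affine : ∀ I → Affine (eval I)
    eval-affine I = affine-evalForm I (affine ∘ decode)

    evalForm-ext : ∀ {m} (I : LinForm m) {β γ : Assignment m} → (∀ k → β k ≡ γ k) →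
      evalForm I β ≡ evalForm I γ
    evalForm-ext []      e = refl
    evalForm-ext (x ∷ I) e = cong₂ _xor_ (cong (x ∧_) (e zero)) (evalForm-ext I (e ∘ suc))

    eval-local : ∀ I {α β} → (∀ v j → free v ≡ true → α (v , j) ≡ β (v , j)) →
      eval I α ≡ eval I β
    eval-local I h = evalForm-ext I λ k → local h (decode k)

    -- Three equal bits z v give a free block the majority z v, and fixed blocks already agree with
    -- every z in `P`.
    realize : ∀ z → P z → blocks (σ (λ (v , j) → z v)) ≗ z
    realize z Pz v with free v in e
    ... | true  = maj-const _ (z v) λ j → identity v e _ j
    ... | false = fixed v e _ z Pz

  open Restriction

  unrestricted : Restriction (λ _ → ⊤)
  unrestricted = record
    { free = λ _ → true ; σ = λ α → α
    ; affine = affine-coordinate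
    ; local = λ { h (v , j) → h v j refl }
    ; identity = λ v e α j → refl
    ; fixed = λ v ()
    }

  module Pivot {P : (V → Bool) → Set} (R : Restriction P) (I : LinForm n) (v : V) (j : Fin 3)
    (v-free : free R v ≡ true) (pivotal : coefficient (eval-affine R I) (v , j) ≡ true)
    (b x : Bool) where

    -- The pivot is filled too, so that `solution`, and with it τ, no longer depends on any variable
    -- of block `v`.
    fill₀ fill₁ fill : (Var → Bool) → Var → Bool
    fill₀ α = α [ v , zero ≔ b ]
    fill₁ α = fill₀ α [ v , suc zero ≔ b ]
    fill  α = fill₁ α [ v , suc (suc zero) ≔ b ]

    fill-same : ∀ α i → fill α (v , i) ≡ b
    fill-same α zero = trans (update-other (fill₁ α) (v , suc (suc zero)) b {v , zero} λ ())
      (trans (update-other (fill₀ α) (v , suc zero) b {v , zero} λ ()) (update-same α (v , zero) b))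
    fill-same α (suc zero) =
      trans (update-other (fill₁ α) (v , suc (suc zero)) b {v , suc zero} λ ())
        (update-same (fill₀ α) (v , suc zero) b)
    fill-same α (suc (suc zero)) = update-same (fill₁ α) (v , suc (suc zero)) b

    fill-other : ∀ α {v′} i → v′ ≢ v → fill α (v′ , i) ≡ α (v′ , i)
    fill-other α {v′} i ne =
      trans (update-other (fill₁ α) (v , suc (suc zero)) b {v′ , i} (ne ∘ cong proj₁))
        (trans (update-other (fill₀ α) (v , suc zero) b {v′ , i} (ne ∘ cong proj₁))
          (update-other α (v , zero) b {v′ , i} (ne ∘ cong proj₁)))

    affine-fill : ∀ {h} → Affine h → Affine (h ∘ fill)
    affine-fill p = affine-update _ b (affine-update _ b (affine-update _ b p))

    -- The pivot has coefficient 1 and currently holds `b`, so changing it to y adds y xor b to the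
    -- form; this is the y that makes the form equal to `x`.
    solution : (Var → Bool) → Bool
    solution α = b xor (eval R I (fill α) xor x)

    τ : (Var → Bool) → Var → Bool
    τ α = fill α [ v , j ≔ solution α ]

    τ-same : ∀ α i → i ≢ j → τ α (v , i) ≡ b
    τ-same α i ne = trans (update-other (fill α) (v , j) (solution α) {v , i} (ne ∘ cong proj₂)) (fill-same α i)

    τ-other : ∀ α {v′} i → v′ ≢ v → τ α (v′ , i) ≡ α (v′ , i)
    τ-other α i ne = trans (update-other (fill α) (v , j) (solution α) {_ , i} (ne ∘ cong proj₁)) (fill-other α i ne)

    eval-τ : ∀ α → eval R I (τ α) ≡ x
    eval-τ α = trans (update (eval-affine R I) (v , j) (fill α) (solution α))
      (trans (cong₂ (λ c y → e xor (c ∧ (solution α xor y))) pivotal (fill-same α j)) (cancel e b x))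
      where
      e = eval R I (fill α)
      cancel : ∀ e b x → e xor ((b xor (e xor x)) xor b) ≡ x
      cancel = solve 3 (λ e b x → e :+ ((b :+ (e :+ x)) :+ b) := x) refl
        where open BoolSolver.xor-∧-Solver

    affine-τ : ∀ {h} → Affine h → Affine (h ∘ τ)
    affine-τ {h} p = let c = coefficient p (v , j) in
      affine-≗ (λ α → sym (trans (update p (v , j) (fill α) (solution α))
          (cong (λ y → h (fill α) xor (c ∧ (solution α xor y))) (fill-same α j))))
        (affine-xor (affine-fill p)
          (affine-∧ c (affine-xor
            (affine-xor (affine-const b)
              (affine-xor (affine-fill (eval-affine R I)) (affine-const x)))
            (affine-const b))))

    free′ : V → Bool
    free′ v′ = if does (v′ ≟ᵛ v) then false else free R v′

    free′-≢ : ∀ v′ → free′ v′ ≡ true → v′ ≢ v × free R v′ ≡ true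
    free′-≢ v′ e with v′ ≟ᵛ v
    ... | no ne = ne , e

    τ-local : ∀ {α β} → (∀ v′ i → free′ v′ ≡ true → α (v′ , i) ≡ β (v′ , i)) →
      ∀ v′ i → free R v′ ≡ true → τ α (v′ , i) ≡ τ β (v′ , i)
    τ-local {α} {β} h v′ i e =
      trans (cong (λ s → (fill α [ v , j ≔ s ]) (v′ , i)) same-solution) update-fill
      where
      fill-local : ∀ v′ i → free R v′ ≡ true → fill α (v′ , i) ≡ fill β (v′ , i)
      fill-local v′ i e with v′ ≟ᵛ v in e′
      ... | yes refl = trans (fill-same α i) (sym (fill-same β i))
      ... | no  ne   = trans (fill-other α i ne)
        (trans (h v′ i (trans (cong (λ d → if does d then false else free R v′) e′) e))
          (sym (fill-other β i ne)))

      same-solution : solution α ≡ solution β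
      same-solution = cong (λ y → b xor (y xor x)) (eval-local R I fill-local)

      update-fill : (fill α [ v , j ≔ solution β ]) (v′ , i) ≡ τ β (v′ , i)
      update-fill with (v′ , i) ≟ (v , j)
      ... | yes _ = refl
      ... | no  _ = fill-local v′ i e

    restricted : Restriction (P ∩ v ≔ b)
    restricted = record
      { free = free′
      ; σ = σ R ∘ τ
      ; affine = λ w → affine-τ (affine R w)
      ; local = λ h → local R (τ-local h)
      ; identity = λ v′ e α i → let (ne , e′) = free′-≢ v′ e in
          trans (identity R v′ e′ (τ α) i) (τ-other α i ne)
      ; fixed = fixed′
      }
      where
      fixed′ : ∀ v′ → free′ v′ ≡ false → ∀ α z → (P ∩ v ≔ b) z → blocks (σ R (τ α)) v′ ≡ z v′
      fixed′ v′ e α z (Pz , zv) with v′ ≟ᵛ v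
      ... | yes refl = trans
            (maj-stifled _ j b λ i ne → trans (identity R v v-free (τ α) i) (τ-same α i ne))
            (sym zv)
      ... | no  _    = fixed R v′ e (τ α) z Pz

  -- By locality the form ignores the variables of a fixed block, whereas changing a variable with
  -- coefficient 1 flips it.
  pivot-free : ∀ {P} (R : Restriction P) I v j → coefficient (eval-affine R I) (v , j) ≡ true →
    free R v ≡ true
  pivot-free R I v j e with free R v in fv
  ... | true  = refl
  ... | false = ⊥-elim (flips _ (trans (trans (eval-local R I same)
          (update (eval-affine R I) (v , j) (λ _ → false) true))
        (cong (λ c → eval R I (λ _ → false) xor (c ∧ true)) e)))
    where
    same : ∀ v′ i → free R v′ ≡ true → false ≡ ((λ _ → false) [ v , j ≔ true ]) (v′ , i)
    same v′ i e′ = sym (update-other (λ _ → false) (v , j) true λ eq →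
      contradiction (trans (sym e′) (trans (cong (free R ∘ proj₁) eq) fv)) λ ())

    flips : ∀ y → y ≢ y xor true
    flips false ()
    flips true  ()

  -- Invariant of the walk from the empty clause towards the axioms: the current line is false on
  -- the whole affine subspace parametrised by `σ R`.
  Falsifies : ∀ {P} → Restriction P → LinClause n → Set
  Falsifies R D = ∀ α → ¬ LinSat (λ k → σ R α (decode k)) D

  module _ {F : CNF n}
    (labelled : ∀ {C} → C ∈ F → ∃ λ x → ∀ β →
      ¬ LinSat (λ k → β (decode k)) (clauseToLin C) → g (blocks β) ≡ x) where

    -- A query to a non-constant form is charged to a variable of g, and both
    -- answers to the form remain possible.
    size-bound : ∀ d {D P} (π : TreeDeriv F D) (R : Restriction P) → Hard g d P →
      Falsifies R D → 2 ^ d ≤ size π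
    size-bound zero (axiom _)           R h fls = s≤s z≤n
    size-bound zero (res _ _ _ _ _ _ _) R h fls = s≤s z≤n
    size-bound zero (weak _ _)          R h fls = s≤s z≤n
    -- An axiom falsified on the subspace fixes the value of `g` there, but with a query left both
    -- values are still realised.
    size-bound (suc d) (axiom C∈F) R (w , _) fls =
      let (x , lab)     = labelled C∈F
          (z , gz , Pz) = w (not x)
          z∈P           = Pz z (λ _ → refl)
          gz′           = trans (sym (g-ext (realize R z z∈P))) (lab (σ R λ (v , j) → z v) (fls λ (v , j) → z v))
      in contradiction (trans (sym gz) gz′) (not-≢ x)
      where
      not-≢ : ∀ x → not x ≢ x
      not-≢ false ()
      not-≢ true  ()
    size-bound (suc d) (weak π C⇒D) R h fls =
      ≤-trans (size-bound (suc d) π R h λ α s → fls α (C⇒D _ s)) (n≤1+n _)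
    size-bound (suc d) (res {P₁} {P₂} I C D π₁ π₂ P₁↭ P₂↭) R h fls
      with pivot? (eval-affine R I) finite
    -- A constant form leaves one premise falsified on the subspace; the walk moves on to it without
    -- spending a query.
    ... | inj₂ none = by-value (eval R I λ _ → false) refl
      where
      value : ∀ α → eval R I α ≡ eval R I (λ _ → false)
      value α = constant (eval-affine R I) (λ e → eval-local R I λ v j _ → e (v , j)) none
        (proj₁ finite) α _ λ w w∉ → contradiction (proj₂ finite w) w∉

      by-value : ∀ y → eval R I (λ _ → false) ≡ y →
        2 ^ suc d ≤ suc (size π₁ + size π₂)
      by-value true e = ≤-trans
        (size-bound (suc d) π₁ R h λ α s → premise α (Any-resp-↭ P₁↭ s))
        (≤-trans (m≤m+n (size π₁) (size π₂)) (n≤1+n _))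
        where
        premise : ∀ α → ¬ LinSat (λ k → σ R α (decode k)) ((I , false) ∷ C)
        premise α (here s)  = contradiction (trans (sym s) (trans (value α) e)) λ ()
        premise α (there s) = fls α (Any.++⁺ˡ s)
      by-value false e = ≤-trans
        (size-bound (suc d) π₂ R h λ α s → premise α (Any-resp-↭ P₂↭ s))
        (≤-trans (m≤n+m (size π₂) (size π₁)) (n≤1+n _))
        where
        premise : ∀ α → ¬ LinSat (λ k → σ R α (decode k)) ((I , true) ∷ D)
        premise α (here s)  = contradiction (trans (sym s) (trans (value α) e)) λ ()
        premise α (there s) = fls α (Any.++⁺ʳ C s)
    ... | inj₁ ((v , j) , pivotal) =
      ≤-trans (+-mono-≤ side₁ (≤-trans (≤-reflexive (+-identityʳ (2 ^ d))) side₂)) (n≤1+n _)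
      where
      -- The block gets this same value for either value of the form, so both subtrees inherit one
      -- and the same `hard′`; this gives the doubling.
      b = proj₁ (proj₂ h v)
      hard′ = proj₂ (proj₂ h v)
      open Pivot R I v j (pivot-free R I v j pivotal) pivotal b

      side₁ : 2 ^ d ≤ size π₁
      side₁ = size-bound d π₁ (restricted true) hard′ λ α s → premise α (Any-resp-↭ P₁↭ s)
        where
        premise : ∀ α → ¬ LinSat (λ k → σ R (τ true α) (decode k)) ((I , false) ∷ C)
        premise α (here s)  = contradiction (trans (sym s) (eval-τ true α)) λ ()
        premise α (there s) = fls (τ true α) (Any.++⁺ˡ s)

      side₂ : 2 ^ d ≤ size π₂
      side₂ = size-bound d π₂ (restricted false) hard′ λ α s → premise α (Any-resp-↭ P₂↭ s)
        where
        premise : ∀ α → ¬ LinSat (λ k → σ R (τ false α) (decode k)) ((I , true) ∷ D)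
        premise α (here s)  = contradiction (trans (sym s) (eval-τ false α)) λ ()
        premise α (there s) = fls (τ false α) (Any.++⁺ʳ C s)

-- Hitting formulas from partitions

Cube : Set → Set
Cube V = List (V × Bool)

Holds : (V → Bool) → Cube V → Set
Holds α = All λ (v , b) → α v ≡ b

extend : V → Bool → Cube V × X → Cube V × X
extend v b (c , x) = (v , b) ∷ c , x

cubes : Prog V X → List (Cube V × X)
cubes (ret x)   = [ [] , x ]
cubes fail      = []
cubes (ask v k) = map (extend v false) (cubes (k false)) ++ map (extend v true) (cubes (k true))
cubes (guess k) = cubes (k false) ++ cubes (k true)

cube-outcome : (p : Prog V X) (α : V → Bool) {c : Cube V} {x : X} →
  (c , x) ∈ cubes p → Holds α c → x ∈ outcomes p α
cube-outcome (ret x) α (here refl) h = here refl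
cube-outcome (ask v k) α m h with ∈-++⁻ (map (extend v false) (cubes (k false))) m
cube-outcome (ask v k) α m h | inj₁ m₀ with ∈-map⁻ (extend v false) m₀
cube-outcome (ask v k) α m (e ∷ h) | inj₁ _ | _ , m′ , refl rewrite e = cube-outcome (k false) α m′ h
cube-outcome (ask v k) α m h | inj₂ m₁ with ∈-map⁻ (extend v true) m₁
cube-outcome (ask v k) α m (e ∷ h) | inj₂ _ | _ , m′ , refl rewrite e = cube-outcome (k true) α m′ h
cube-outcome (guess k) α m h with ∈-++⁻ (cubes (k false)) m
... | inj₁ m₀ = ∈-++⁺ˡ (cube-outcome (k false) α m₀ h)
... | inj₂ m₁ = ∈-++⁺ʳ (outcomes (k false) α) (cube-outcome (k true) α m₁ h)

outcome-cube : (p : Prog V X) (α : V → Bool) {x : X} → x ∈ outcomes p α →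
  ∃ λ c → (c , x) ∈ cubes p × Holds α c
outcome-cube (ret x) α (here refl) = [] , here refl , []
outcome-cube (ask v k) α m with α v in e
... | false = let (c , c∈ , h) = outcome-cube (k false) α m in
  (v , false) ∷ c , ∈-++⁺ˡ (∈-map⁺ (extend v false) c∈) , e ∷ h
... | true  = let (c , c∈ , h) = outcome-cube (k true) α m in
  (v , true) ∷ c , ∈-++⁺ʳ (map (extend v false) (cubes (k false))) (∈-map⁺ (extend v true) c∈) , e ∷ h
outcome-cube (guess k) α m with ∈-++⁻ (outcomes (k false) α) m
... | inj₁ m₀ = let (c , c∈ , h) = outcome-cube (k false) α m₀ in c , ∈-++⁺ˡ c∈ , h
... | inj₂ m₁ = let (c , c∈ , h) = outcome-cube (k true) α m₁ in c , ∈-++⁺ʳ (cubes (k false)) c∈ , h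

Apart : ((V → Bool) → Set) → Cube V × X → Cube V × X → Set
Apart P (c , _) (d , _) = ∀ α → P α → Holds α c → Holds α d → ⊥

∈⇒1≤length : {x : X} {xs : List X} → x ∈ xs → 1 ≤ length xs
∈⇒1≤length (here _)  = s≤s z≤n
∈⇒1≤length (there _) = s≤s z≤n

-- `P` collects the answers on the path so far: a subprogram is known to be unambiguous only on
-- inputs that reach it. At a guess, an input in cubes of both branches would have two outcomes.
cubes-apart : (P : (V → Bool) → Set) (p : Prog V X) → (∀ α → P α → length (outcomes p α) ≤ 1) →
  AllPairs (Apart P) (cubes p)
cubes-apart P (ret x)   h = [] ∷ []
cubes-apart P fail      h = []
cubes-apart {V} {X} P (ask v k) h = AllPairs.++⁺ (branch false) (branch true)
  (All.map⁺ (All.universal (λ _ → All.map⁺ (All.universal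
    (λ { _ α _ (e₀ ∷ _) (e₁ ∷ _) → contradiction (trans (sym e₀) e₁) λ () }) _)) _))
  where
  branch : ∀ b → AllPairs (Apart P) (map (extend v b) (cubes (k b)))
  branch b = AllPairs.map⁺ (AllPairs.map (λ {c} {d} a α Pα → λ { (e ∷ h₀) (_ ∷ h₁) → a α (Pα , e) h₀ h₁ })
    (cubes-apart (P ∩ v ≔ b) (k b) λ { α (Pα , refl) → h α Pα }))
cubes-apart P (guess k) h = AllPairs.++⁺
  (cubes-apart P (k false) λ α Pα → ≤-trans (≤-trans (m≤m+n _ _) (≤-reflexive (sym (length-++ (outcomes (k false) α))))) (h α Pα))
  (cubes-apart P (k true)  λ α Pα → ≤-trans (≤-trans (m≤n+m _ _) (≤-reflexive (sym (length-++ (outcomes (k false) α))))) (h α Pα))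
  (All.tabulate λ {c} c∈ → All.tabulate λ {d} d∈ α Pα hc hd →
    contradiction
      (≤-trans (+-mono-≤ (∈⇒1≤length (cube-outcome (k false) α c∈ hc)) (∈⇒1≤length (cube-outcome (k true) α d∈ hd)))
        (≤-trans (≤-reflexive (sym (length-++ (outcomes (k false) α)))) (h α Pα)))
      λ { (s≤s ()) })

Width≤ : (X → ℕ) → ℕ → Cube V × X → Set
Width≤ B n (c , x) = length c + n ≤ B x

cubes-width : (p : Prog V X) {n : ℕ} {B : X → ℕ} → Within n p B → All (Width≤ B n) (cubes p)
cubes-width (ret x)   h = h ∷ []
cubes-width fail      h = []
cubes-width {V} {X} (ask v k) {n} {B} h = All.++⁺ (branch false) (branch true)
  where
  branch : ∀ b → All (Width≤ B n) (map (extend v b) (cubes (k b)))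
  branch b = All.map⁺ (All.map (λ {(c , x)} → ≤-trans (≤-reflexive (sym (+-suc (length c) n))))
    (cubes-width (k b) (h b)))
cubes-width (guess k) {n} {B} h = All.++⁺ (branch false) (branch true)
  where
  branch : ∀ b → All (Width≤ B n) (cubes (k b))
  branch b = All.map (λ {(c , x)} → ≤-trans (+-monoʳ-≤ (length c) (n≤1+n n))) (cubes-width (k b) (h b))

halve : ∀ x y {n w} → x * 2 ^ suc n ≤ 2 ^ w → y * 2 ^ suc n ≤ 2 ^ w → (x + y) * 2 ^ n ≤ 2 ^ w
halve x y {n} {w} p q = *-cancelˡ-≤ 2 (begin
  2 * ((x + y) * 2 ^ n)           ≡⟨ solve 3 (λ x y z → con 2 :* ((x :+ y) :* z)
                                       := x :* (con 2 :* z) :+ y :* (con 2 :* z)) refl x y (2 ^ n) ⟩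
  x * 2 ^ suc n + y * 2 ^ suc n   ≤⟨ +-mono-≤ p (≤-trans q (≤-reflexive (sym (+-identityʳ (2 ^ w))))) ⟩
  2 * 2 ^ w                       ∎)
  where
  open ≤-Reasoning
  open +-*-Solver

-- With `n` charges spent, at most w - n binary branchings remain; multiplying out avoids the
-- subtraction.
kraft : (p : Prog V X) {n w : ℕ} → Within n p (λ _ → w) → length (cubes p) * 2 ^ n ≤ 2 ^ w
kraft (ret x)   {n} h = ≤-trans (≤-reflexive (*-identityˡ (2 ^ n))) (^-monoʳ-≤ 2 h)
kraft fail      h = z≤n
kraft (ask v k) {n} {w} h
  rewrite length-++ (map (extend v false) (cubes (k false))) {map (extend v true) (cubes (k true))}
        | length-map (extend v false) (cubes (k false))
        | length-map (extend v true) (cubes (k true))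
  = halve (length (cubes (k false))) _ {n} {w} (kraft (k false) (h false)) (kraft (k true) (h true))
kraft (guess k) {n} {w} h rewrite length-++ (cubes (k false)) {cubes (k true)}
  = halve (length (cubes (k false))) _ {n} {w} (kraft (k false) (h false)) (kraft (k true) (h true))

evalForm-false : ∀ {n} (α : Assignment n) → evalForm (tabulate λ _ → false) α ≡ false
evalForm-false {zero}  α = refl
evalForm-false {suc n} α = evalForm-false (α ∘ suc)

evalForm-unit : ∀ {n} (i : Fin n) (α : Assignment n) →
  evalForm (tabulate λ j → ⌊ j Fin.≟ i ⌋) α ≡ α i
evalForm-unit zero    α = trans (cong (α zero xor_) (evalForm-false (α ∘ suc))) (xor-identityʳ (α zero))
evalForm-unit {suc n} (suc i) α = trans
  (cong (λ I → evalForm I (α ∘ suc)) (tabulate-cong λ j → isYes-map′ (j Fin.≟ i)))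
  (evalForm-unit i (α ∘ suc))
  where
  isYes-map′ : ∀ {A B : Set} {f : A → B} {g : B → A} (d : Dec A) → ⌊ map′ f g d ⌋ ≡ ⌊ d ⌋
  isYes-map′ d = trans (isYes≗does (map′ _ _ d)) (sym (isYes≗does d))

finite-≟ : Finite V → DecidableEquality V
finite-≟ (xs , enum) v w = map′
  (λ e → trans (Any.lookup-index (enum v)) (trans (cong (List.lookup xs) e) (sym (Any.lookup-index (enum w)))))
  (cong λ v → index (enum v)) (index (enum v) Fin.≟ index (enum w))

allPairs-lookup : {R : X → X → Set} → (∀ {x y} → R x y → R y x) → {xs : List X} →
  AllPairs R xs → ∀ i j → i ≢ j → R (List.lookup xs i) (List.lookup xs j)
allPairs-lookup R-sym (r ∷ rs) zero    zero    i≢j = contradiction refl i≢j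
allPairs-lookup R-sym (r ∷ rs) zero    (suc j) i≢j = All.lookup r (∈-lookup j)
allPairs-lookup R-sym (r ∷ rs) (suc i) zero    i≢j = R-sym (All.lookup r (∈-lookup i))
allPairs-lookup R-sym (r ∷ rs) (suc i) (suc j) i≢j = allPairs-lookup R-sym rs i j (i≢j ∘ cong suc)

allPairs-refine : {P : X → Set} {R S : X → X → Set} → (∀ {x y} → P x → P y → R x y → S x y) →
  {xs : List X} → All P xs → AllPairs R xs → AllPairs S xs
allPairs-refine f []       []       = []
allPairs-refine f (p ∷ ps) (r ∷ rs) =
  All.zipWith (λ (q , r) → f p q r) (ps , r) ∷ allPairs-refine f ps rs

module Formula {V : Set} (finite : Finite V) where

  _≟_ : DecidableEquality V
  _≟_ = finite-≟ finite

  open DecMembership (Product.≡-dec _≟_ Bool._≟_) using (_∈?_)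

  size-V : ℕ
  size-V = length (proj₁ finite)

  encode : V → Fin size-V
  encode v = index (proj₂ finite v)

  decode : Fin size-V → V
  decode = List.lookup (proj₁ finite)

  decode-encode : ∀ v → decode (encode v) ≡ v
  decode-encode v = sym (Any.lookup-index (proj₂ finite v))

  Clash : Cube V → Cube V → Set
  Clash c d = Any (λ (v , b) → (v , not b) ∈ d) c

  clash? : ∀ c d → Dec (Clash c d)
  clash? c d = any? (λ (v , b) → (v , not b) ∈? d) c

  Consistent : Cube V → Set
  Consistent c = ¬ Clash c c

  clash-literals : ∀ {c d} → Clash c d → ∃ λ v → ∃ λ b → (v , b) ∈ c × (v , not b) ∈ d
  clash-literals (here {x = v , b} m) = v , b , here refl , m
  clash-literals (there cl) = let (v , b , p , q) = clash-literals cl in v , b , there p , q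

  clash-intro : ∀ {c d v b} → (v , b) ∈ c → (v , not b) ∈ d → Clash c d
  clash-intro (here refl) q = here q
  clash-intro (there p)   q = there (clash-intro p q)

  holds⇒consistent : ∀ {α c} → Holds α c → Consistent c
  holds⇒consistent h cl = let (v , b , p , q) = clash-literals cl in
    not-¬ refl (trans (sym (All.lookup h p)) (All.lookup h q))

  -- Without a clash, two consistent cubes meet in the point whose true variables are exactly those
  -- occurring positively in one of them.
  apart⇒clash : ∀ {x y : Cube V × X} → Consistent (proj₁ x) → Consistent (proj₁ y) →
    Apart (λ _ → ⊤) x y → Clash (proj₁ x) (proj₁ y)
  apart⇒clash {x = c , _} {d , _} cc cd apart with clash? c d
  ... | yes cl = cl
  ... | no ¬cl = ⊥-elim (apart α tt
      (All.tabulate λ {(v , b)} → holds-c v b) (All.tabulate λ {(v , b)} → holds-d v b))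
    where
    α : V → Bool
    α v = does ((v , true) ∈? (c ++ d))

    holds-c : ∀ v b → (v , b) ∈ c → α v ≡ b
    holds-c v true  m = dec-true ((v , true) ∈? (c ++ d)) (∈-++⁺ˡ m)
    holds-c v false m = dec-false ((v , true) ∈? (c ++ d)) λ m′ →
      [ (λ p → cc (clash-intro m p)) , (λ p → ¬cl (clash-intro m p)) ]′ (∈-++⁻ c m′)

    holds-d : ∀ v b → (v , b) ∈ d → α v ≡ b
    holds-d v true  m = dec-true ((v , true) ∈? (c ++ d)) (∈-++⁺ʳ c m)
    holds-d v false m = dec-false ((v , true) ∈? (c ++ d)) λ m′ →
      [ (λ p → ¬cl (clash-intro p m)) , (λ p → cd (clash-intro m p)) ]′ (∈-++⁻ c m′)

  clause : Cube V × X → Clause size-V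
  clause (c , _) = map (λ (v , b) → encode v , not b) c

  clash⇒clashing : ∀ {x y : Cube V × X} → Clash (proj₁ x) (proj₁ y) → Clashing (clause x) (clause y)
  clash⇒clashing cl = let (v , b , p , q) = clash-literals cl in
    encode v , not b , ∈-map⁺ _ p , ∈-map⁺ _ q

  clashing-sym : ∀ {n} {C D : Clause n} → Clashing C D → Clashing D C
  clashing-sym {D = D} (i , b , p , q) =
    i , not b , q , subst (λ b → (i , b) ∈ _) (sym (not-involutive b)) p

  consistent? : (x : Cube V × X) → Dec (Consistent (proj₁ x))
  consistent? (c , _) = ¬? (clash? c c)

  -- A program may ask a variable twice, which produces empty cubes with contradictory literals.
  -- These are disjoint from every cube without having to clash with it, so they are removed.
  formula : Prog V X → CNF size-V
  formula p = map clause (filter consistent? (cubes p))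

  formula-unsat : (p : Prog V X) {f : (V → Bool) → X} → Computes p f → Unsatisfiable (formula p)
  formula-unsat {X} p {f} comp α sat =
    let β = α ∘ encode
        (c , c∈ , h) = outcome-cube p β (subst (f β ∈_) (sym (comp β)) (here refl))
        c∈F = ∈-map⁺ clause (∈-filter⁺ consistent? c∈ (holds⇒consistent h))
    in falsified {x = f β} h (All.lookup sat c∈F)
    where
    falsified : ∀ {c} {x : X} → Holds (α ∘ encode) c → ¬ ClauseSat α (clause (c , x))
    falsified (e ∷ h) (here s)  = not-¬ refl (trans (sym e) s)
    falsified {x = x} (e ∷ h) (there s) = falsified {x = x} h s

  formula-hitting : (p : Prog V X) {f : (V → Bool) → X} → Computes p f → Hitting (formula p)
  formula-hitting p comp = allPairs-lookup (λ {C} {D} → clashing-sym {C = C} {D}) (AllPairs.map⁺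
    (allPairs-refine (λ {x} {y} cx cy a → clash⇒clashing {x = x} {y} (apart⇒clash {x = x} {y} cx cy a))
      (All.all-filter consistent? (cubes p))
      (AllPairs.filter⁺ consistent?
        (cubes-apart (λ _ → ⊤) p λ α _ → ≤-reflexive (cong length (comp α))))))

  formula-width : (p : Prog V X) {w : ℕ} → Cost p (λ _ → w) → All (λ C → width C ≤ w) (formula p)
  formula-width p c = All.map⁺ (All.filter⁺ consistent? (All.map (λ {(d , x)} h →
    ≤-trans (≤-reflexive (trans (length-map _ d) (sym (+-identityʳ (length d))))) h) (cubes-width p c)))

  formula-length : (p : Prog V X) {w : ℕ} → Cost p (λ _ → w) → length (formula p) ≤ 2 ^ w
  formula-length p {w} c = begin
    length (formula p)                       ≡⟨ length-map clause (filter consistent? (cubes p)) ⟩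
    length (filter consistent? (cubes p))    ≤⟨ length-filter consistent? (cubes p) ⟩
    length (cubes p)                         ≡⟨ *-identityʳ _ ⟨
    length (cubes p) * 2 ^ 0                 ≤⟨ kraft p c ⟩
    2 ^ w                                    ∎
    where open ≤-Reasoning

  -- Falsifying a clause places β in its cube, whose label is then an outcome on β, and there is
  -- only one.
  formula-label : (p : Prog V X) {f : (V → Bool) → X} → Computes p f → ∀ {C} → C ∈ formula p →
    ∃ λ x → ∀ β → ¬ LinSat (β ∘ decode) (clauseToLin C) → f β ≡ x
  formula-label {X} p {f} comp C∈F with ∈-map⁻ clause C∈F
  ... | (c , x) , m , refl = x , λ β ¬sat → only (subst (x ∈_) (comp β)
          (cube-outcome p β (proj₁ (∈-filter⁻ consistent? {xs = cubes p} m)) (unsat⇒holds c β ¬sat)))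
    where
    only : ∀ {y} → x ∈ [ y ] → y ≡ x
    only (here refl) = refl

    unsat⇒holds : ∀ c β → ¬ LinSat (β ∘ decode) (clauseToLin (clause {X} (c , x))) → Holds β c
    unsat⇒holds []            β ¬sat = []
    unsat⇒holds ((v , b) ∷ c) β ¬sat =
      trans (¬-not λ e → ¬sat (here (trans (evalForm-unit (encode v) (β ∘ decode))
        (trans (cong β (decode-encode v)) e)))) (not-involutive b)
      ∷ unsat⇒holds c β (¬sat ∘ there)

-- The main construction

majority : V → Prog (V × Fin 3) Bool
majority v = ask (v , zero) λ a → ask (v , suc zero) λ b →
  if a xor b then ask (v , suc (suc zero)) ret else ret a

majority-computes : (v : V) → Computes (majority v) (λ α → blocks α v)
majority-computes v α with α (v , zero) xor α (v , suc zero)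
... | false = refl
... | true  = refl

majority-cost : (v : V) → Cost (majority v) (λ _ → 3)
majority-cost v false false = n≤1+n 2
majority-cost v false true  = λ b → ≤-refl
majority-cost v true  false = λ b → ≤-refl
majority-cost v true  true  = n≤1+n 2

module Lifted {c₁ c₀ u d : ℕ} (A : System c₁ c₀ u u d) where
  open System A
  open Formula (finite-× finite-Var (finite-Fin 3))

  lifted : Prog (Var × Fin 3) Bool
  lifted = subst-ask majority partition

  lifted-comp : Computes lifted (f ∘ blocks)
  lifted-comp α = trans (outcomes-subst-ask majority-computes partition α) (partition-comp (blocks α))

  lifted-cost : Cost lifted (λ _ → u * 3)
  lifted-cost = within-subst-ask 3 majority-cost (λ ()) partition {B = λ _ → u}
    (within-mono partition ≤-refl (λ { false → ≤-refl ; true → ≤-refl }) partition-cost)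

  cnf : Σ ℕ CNF
  cnf = size-V , formula lifted

  cnf-unsat : Unsatisfiable (proj₂ cnf)
  cnf-unsat = formula-unsat lifted lifted-comp

  cnf-hitting : Hitting (proj₂ cnf)
  cnf-hitting = formula-hitting lifted lifted-comp

  cnf-length : length (proj₂ cnf) ≤ 2 ^ (u * 3)
  cnf-length = formula-length lifted lifted-cost

  cnf-width : All (λ C → width C ≤ u * 3) (proj₂ cnf)
  cnf-width = formula-width lifted lifted-cost

  cnf-size : (π : TreeRefutation (proj₂ cnf)) → 2 ^ d ≤ size π
  cnf-size π = size-bound (formula-label lifted lifted-comp) d π unrestricted hard λ α ()
    where
    open Lifting _≟_ (finite-× finite-Var (finite-Fin 3)) (finite-≟ finite-Var) decode f
      (computes-ext {p = partition} partition-comp)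

-- Logarithms and the choice of parameters

^-distribʳ-* : ∀ n x y → (x * y) ^ n ≡ x ^ n * y ^ n
^-distribʳ-* zero    x y = refl
^-distribʳ-* (suc n) x y =
  trans (cong (x * y *_) (^-distribʳ-* n x y)) ([m*n]*[o*p]≡[m*o]*[n*p] x y (x ^ n) (y ^ n))

2^log≤ : ∀ n → .{{NonZero n}} → 2 ^ ⌊log₂ n ⌋ ≤ n
2^log≤ (suc n) = bound n (<-wellFounded (suc n))
  where
  open ≤-Reasoning
  -- General in the accessibility proof, since `⌊log2⌋` recurses on it.
  bound : ∀ n (a : Acc _<_ (suc n)) → 2 ^ ⌊log2⌋ (suc n) a ≤ suc n
  bound zero    _        = ≤-refl
  bound (suc n) (acc rs) = begin
    2 * 2 ^ ⌊log2⌋ (suc ⌊ n /2⌋) _           ≤⟨ *-monoʳ-≤ 2 (bound ⌊ n /2⌋ _) ⟩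
    2 * suc ⌊ n /2⌋                          ≡⟨ solve 1 (λ x → con 2 :* (con 1 :+ x) := con 2 :+ (x :+ x)) refl ⌊ n /2⌋ ⟩
    2 + (⌊ n /2⌋ + ⌊ n /2⌋)                  ≤⟨ +-monoʳ-≤ (2 + ⌊ n /2⌋) (⌊n/2⌋≤⌈n/2⌉ n) ⟩
    2 + (⌊ n /2⌋ + ⌈ n /2⌉)                  ≡⟨ cong (2 +_) (⌊n/2⌋+⌈n/2⌉≡n n) ⟩
    2 + n                                    ∎
    where open +-*-Solver

<2^log : ∀ n → n < 2 ^ suc ⌊log₂ n ⌋
<2^log n with n <? 2 ^ suc ⌊log₂ n ⌋
... | yes lt = lt
... | no  ge = contradiction′ (≤-trans (≤-reflexive (sym (⌊log₂[2^n]⌋≡n (suc ⌊log₂ n ⌋))))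
                 (⌊log₂⌋-mono-≤ (≮⇒≥ ge)))
  where
  contradiction′ : suc ⌊log₂ n ⌋ ≤ ⌊log₂ n ⌋ → n < 2 ^ suc ⌊log₂ n ⌋
  contradiction′ le = ⊥-elim (<-irrefl refl le)

-- Here N = 2 ^ r is about m ^ (1 / 2q), so that, up to logarithms, k rounds give
-- width N ^ (k + 1) ≈ m and depth N ^ 2k ≈ m ^ (2 − 1 / q).
module Parameters (q k : ℕ) (k+1≡2q : suc k ≡ 2 * q) where

  r : ℕ → ℕ
  r m = ⌊log₂ m ⌋ / suc k

  s K C : ℕ
  s = suc (2 * k)
  -- The first summand serves the width: 3 for the majority blocks, 7 s² for each round. The second
  -- serves the depth: rounding `r m` down leaves m ≤ (2 N) ^ (k + 1) instead of N ^ (k + 1).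
  K = 3 * (7 * (s * s)) ^ k + 2 ^ (2 * k)
  C = 2 * k

  system : (m : ℕ) → let open Rounds (r m) k; u = width-bound k * N in
    System (width-bound k) (width-bound k) u u (N ^ (2 * k))
  system m = weaken ≤-refl ≤-refl (m≤m*n (width-bound k) N {{m^n≢0 2 (r m)}}) ≤-refl (rounds k ≤-refl)
    where open Rounds (r m) k

  module _ (m : ℕ) .{{m≢0 : NonZero m}} where
    open Rounds (r m) k
    open ≤-Reasoning
    open +-*-Solver

    r≤log : r m ≤ ⌊log₂ m ⌋
    r≤log = ≤-trans (m≤m*n (r m) (suc k)) (m/n*n≤m ⌊log₂ m ⌋ (suc k))

    M≤ : M ≤ s * L m
    M≤ = begin
      suc (r m * s)             ≤⟨ s≤s (*-monoˡ-≤ s r≤log) ⟩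
      1 + ⌊log₂ m ⌋ * s         ≤⟨ +-monoˡ-≤ (⌊log₂ m ⌋ * s) (s≤s z≤n) ⟩
      s + ⌊log₂ m ⌋ * s         ≡⟨ *-comm (L m) s ⟩
      s * L m                   ∎

    N^suck≤m : N ^ suc k ≤ m
    N^suck≤m = begin
      N ^ suc k                 ≡⟨ ^-*-assoc 2 (r m) (suc k) ⟩
      2 ^ (r m * suc k)         ≤⟨ ^-monoʳ-≤ 2 (m/n*n≤m ⌊log₂ m ⌋ (suc k)) ⟩
      2 ^ ⌊log₂ m ⌋             ≤⟨ 2^log≤ m ⟩
      m                         ∎

    width≤ : width-bound k * N * 3 ≤ K * m * L m ^ C
    width≤ = begin
      (7 * (M * M)) ^ k * N ^ k * N * 3                ≡⟨ solve 3 (λ a b n → a :* b :* n :* con 3 := con 3 :* a :* (n :* b)) refl ((7 * (M * M)) ^ k) (N ^ k) N ⟩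
      3 * (7 * (M * M)) ^ k * N ^ suc k                ≤⟨ *-mono-≤ (*-monoʳ-≤ 3 (^-monoˡ-≤ k (*-monoʳ-≤ 7 (*-mono-≤ M≤ M≤)))) N^suck≤m ⟩
      3 * (7 * (s * L m * (s * L m))) ^ k * m          ≡⟨ cong (λ z → 3 * z ^ k * m) (solve 2 (λ s l → con 7 :* (s :* l :* (s :* l)) := con 7 :* (s :* s) :* (l :* (l :* con 1))) refl s (L m)) ⟩
      3 * (7 * (s * s) * L m ^ 2) ^ k * m              ≡⟨ cong (λ z → 3 * z * m) (trans (^-distribʳ-* k (7 * (s * s)) (L m ^ 2)) (cong ((7 * (s * s)) ^ k *_) (^-*-assoc (L m) 2 k))) ⟩
      3 * ((7 * (s * s)) ^ k * L m ^ C) * m            ≡⟨ solve 3 (λ a l m → con 3 :* (a :* l) :* m := con 3 :* a :* m :* l) refl ((7 * (s * s)) ^ k) (L m ^ C) m ⟩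
      3 * (7 * (s * s)) ^ k * m * L m ^ C              ≤⟨ *-monoˡ-≤ (L m ^ C) (*-monoˡ-≤ m (m≤m+n (3 * (7 * (s * s)) ^ k) (2 ^ (2 * k)))) ⟩
      K * m * L m ^ C                                  ∎

    m≤[2N]^ : m ≤ (2 * N) ^ suc k
    m≤[2N]^ = begin
      m                                ≤⟨ <⇒≤ (<2^log m) ⟩
      2 ^ suc ⌊log₂ m ⌋                ≤⟨ ^-monoʳ-≤ 2 log< ⟩
      2 ^ (suc (r m) * suc k)          ≡⟨ ^-*-assoc 2 (suc (r m)) (suc k) ⟨
      (2 * N) ^ suc k                  ∎
      where
      log< : suc ⌊log₂ m ⌋ ≤ suc (r m) * suc k
      log< = ≤-trans (≤-reflexive (cong suc (m≡m%n+[m/n]*n ⌊log₂ m ⌋ (suc k))))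
        (+-monoˡ-≤ (r m * suc k) (m%n<n ⌊log₂ m ⌋ (suc k)))

    m^k≤ : m ^ k ≤ (K * N ^ (2 * k) * L m ^ C) ^ q
    m^k≤ = begin
      m ^ k                                  ≤⟨ ^-monoˡ-≤ k m≤[2N]^ ⟩
      ((2 * N) ^ suc k) ^ k                  ≡⟨ ^-*-assoc (2 * N) (suc k) k ⟩
      -- Choosing k + 1 = 2q turns the exponent into a multiple of q, so a q-th power of N ^ (2 * k)
      -- appears without roots.
      (2 * N) ^ (suc k * k)                  ≡⟨ cong ((2 * N) ^_) (trans (cong (_* k) k+1≡2q) (solve 2 (λ q k → con 2 :* q :* k := con 2 :* k :* q) refl q k)) ⟩
      (2 * N) ^ (2 * k * q)                  ≡⟨ ^-*-assoc (2 * N) (2 * k) q ⟨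
      ((2 * N) ^ (2 * k)) ^ q                ≡⟨ cong (_^ q) (^-distribʳ-* (2 * k) 2 N) ⟩
      (2 ^ (2 * k) * N ^ (2 * k)) ^ q        ≤⟨ ^-monoˡ-≤ q (*-monoˡ-≤ (N ^ (2 * k)) (m≤n+m (2 ^ (2 * k)) (3 * (7 * (s * s)) ^ k))) ⟩
      (K * N ^ (2 * k)) ^ q                  ≤⟨ ^-monoˡ-≤ q (m≤m*n (K * N ^ (2 * k)) (L m ^ C) {{m^n≢0 (L m) C}}) ⟩
      (K * N ^ (2 * k) * L m ^ C) ^ q        ∎

    -- The construction reaches ε = 1/q, losing one factor m; `m ^ p` absorbs it because p is
    -- positive.
    depth≥ : ∀ p → 0 < p → m ^ (2 * q) ≤ (K * N ^ (2 * k) * L m ^ C) ^ q * m ^ p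
    depth≥ p 0<p = begin
      m ^ (2 * q)                                ≡⟨ cong (m ^_) k+1≡2q ⟨
      m * m ^ k                                  ≡⟨ *-comm m (m ^ k) ⟩
      m ^ k * m                                  ≤⟨ *-mono-≤ m^k≤ (≤-trans (≤-reflexive (sym (*-identityʳ m))) (^-monoʳ-≤ m 0<p)) ⟩
      (K * N ^ (2 * k) * L m ^ C) ^ q * m ^ p    ∎

theorem3p23 : (p q : ℕ) → 0 < p → 0 < q →
    Σ (ℕ → Σ ℕ CNF) λ G → ∃[ k ] ∃[ C ] ∃[ m₀ ]
    ((m : ℕ) → Unsatisfiable (proj₂ (G m)) × Hitting (proj₂ (G m)))
    × ((m : ℕ) → m₀ ≤ m →
    (length (proj₂ (G m)) ≤ 2 ^ (k * m * L m ^ C))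
    × All (λ cl → width cl ≤ k * m * L m ^ C) (proj₂ (G m))
    × ((π : TreeRefutation (proj₂ (G m))) →
    ∃[ t ] (2 ^ t ≤ size π)
    × (m ^ (2 * q) ≤ (k * t * L m ^ C) ^ q * m ^ p)))
theorem3p23 p (suc q) 0<p 0<q =
  (λ m → cnf (system m)) , K , C , 1 ,
  (λ m → cnf-unsat (system m) , cnf-hitting (system m)) ,
  λ { m@(suc _) 1≤m →
      ≤-trans (cnf-length (system m)) (^-monoʳ-≤ 2 (width≤ m)) ,
      All.map (λ h → ≤-trans h (width≤ m)) (cnf-width (system m)) ,
      λ π → (2 ^ r m) ^ (2 * k) , cnf-size (system m) π , depth≥ m p 0<p }
  where
  open Lifted
  k : ℕ
  -- The successor of this number reduces to `2 * suc q`, so `refl` proves the relation between k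
  -- and q.
  k = pred (2 * suc q)
  open Parameters (suc q) k refl
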